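{- If $X=(V,E)$ is a digraph with labeled vertices $v_1,v_2,\ldots,v_n$, then $$W_X=\sum_{\sigma\in\mathbb{S}_V(X,\overline{X})}(-1)^{\varphi(\sigma)}p_{\mathrm{Type}(\sigma)},$$ with $\varphi(\sigma)=\sum_{\gamma}(\ell(\gamma)-1)$, where the summation runs over all cycles $\gamma$ of $\sigma$ that are cycles in $X$ and $\ell(\gamma)$ denotes the length of the cycle $\gamma$.
   Context: A digraph is a pair $X=(V,E)$ with $V$ a finite set and $E\subseteq V\times V$ (loops are allowed). Its complementary digraph is $\overline{X}=(V,(V\times V)\setminus E)$. Write $\mathbb{P}$ for the set of positive integers. If $|V|=n$, a $V$-listing is a bijection $\sigma:[n]\to V$, written $\sigma=(\sigma_1,\ldots,\sigma_n)$. For a coloring $f:V\to\mathbb{P}$, a $V$-listing $\sigma$ is $(f,X)$-friendly if $f(\sigma_1)\le\cdots\le f(\sigma_n)$ and $f(\sigma_j)<f(\sigma_{j+1})$ for each $j\in[n-1]$ with $(\sigma_j,\sigma_{j+1})\in E$. Let $\Sigma_V(f,X)$ be the set of $(f,X)$-friendly $V$-listings. For a digraph $X$ with vertices labeled $v_1,\ldots,v_n$ in a fixed order, the Redei-Berge function in noncommuting variables is the formal power series in noncommuting variables $x_1,x_2,\ldots$ $$W_X=\sum_{f:V\to\mathbb{P}}\#\Sigma_V(f,X)\; x_{f(v_1)}x_{f(v_2)}\cdots x_{f(v_n)}.$$ $\mathbb{S}_V$ is the group of permutations of $V$. A cycle $(c_1,\ldots,c_k)$ of a permutation (sending $c_i\mapsto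 c_{i+1}$, indices mod $k$; fixed points are cycles of length 1) is a cycle of a digraph if all pairs $(c_i,c_{i+1})$ (indices mod $k$) are edges of that digraph; for $k=1$ this means that $(c_1,c_1)$ is an edge. $\mathbb{S}_V(X,\overline{X})$ is the set of $\sigma\in\mathbb{S}_V$ such that each cycle of $\sigma$ is a cycle of $X$ or a cycle of $\overline{X}$. Identifying $v_i$ with $i$, $\mathrm{Type}(\sigma)$ is the set partition of $[n]$ whose blocks are the underlying sets of the cycles of $\sigma$ (fixed points included). For a set partition $\pi$ of $[n]$, the noncommutative power sum is $p_\pi=\sum x_{i_1}x_{i_2}\cdots x_{i_n}$, summed over all sequences $(i_1,\ldots,i_n)$ of positive integers such that $i_j=i_k$ whenever $j$ and $k$ are in the same block of $\pi$. -}

module Defs where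

open import Data.Bool.Base using (if_then_else_)
open import Data.Fin.Base using (Fin; zero; suc; toℕ; punchIn) renaming (_≤_ to _≤ᶠ_; _<_ to _<ᶠ_)
open import Data.Fin.Induction using (<-wellFounded)
open import Data.Fin.Permutation
  using (Permutation′; _⟨$⟩ʳ_; id; insert; remove; insert-remove; insert-punchIn; _≈_)
open import Data.Fin.Properties as Fin using (punchIn-injective; pigeonhole)
open import Data.Fin.Subset using (Subset; _∈_; Nonempty; ⁅_⁆; ⋃)
open import Data.Fin.Subset.Properties using (_∈?_; x∈⁅x⁆; x∈⁅y⁆⇒x≡y; x∈p∪q⁺; x∈p∪q⁻; ∉⊥)
open import Data.Integer.Base using (ℤ; 0ℤ; 1ℤ; +_) renaming (_+_ to _+ᶻ_; _*_ to _*ᶻ_)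
open import Data.List.Base
  using (List; []; _∷_; [_]; _∷ʳ_; map; concatMap; filter; takeWhile; iterate; tabulate; allFin; lookup; length; foldr)
open import Data.List.Membership.Propositional using (find) renaming (_∈_ to _∈ˡ_)
open import Data.List.Membership.Propositional.Properties using (∈-allFin; ∈-filter⁺)
open import Data.List.NonEmpty.Base as List⁺ using (List⁺; _∷_)
open import Data.List.Relation.Unary.All as All using (All; []; _∷_)
open import Data.List.Relation.Unary.All.Properties as Allₚ using ()
open import Data.List.Relation.Unary.AllPairs as AllPairs using (AllPairs; []; _∷_)
open import Data.List.Relation.Unary.AllPairs.Properties as AllPairsₚ using ()
open import Data.List.Relation.Unary.Any as Any using (Any; here; there)
open import Data.List.Relation.Unary.Any.Properties as Anyₚ using ()
open import Data.List.Relation.Unary.Linked using (Linked; linked?)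
open import Data.List.Relation.Unary.Unique.Propositional using (Unique)
open import Data.List.Relation.Unary.Unique.Propositional.Properties using (allFin⁺; filter⁺)
open import Data.Nat.Base as ℕ using (ℕ; zero; suc; NonZero; _∸_)
open import Data.Nat.ListAction using (sum)
import Data.Nat.Properties as ℕ
open import Data.Product.Base using (∃; _×_; _,_; proj₁; proj₂)
open import Data.Refinement using (Refinement-syntax; value) renaming (_≟_ to refinement-≟)
open import Data.Sum.Base using (_⊎_; inj₁; inj₂)
open import Function.Base using (_∘_)
open import Function.Bundles using (Injection)
open import Function.Properties.Inverse using (↔⇒↣)
open import Induction.WellFounded using (Acc; acc)
open import Level using (0ℓ)
open import Relation.Binary.Core using (Rel)
open import Relation.Binary.Definitions using (Decidable; DecidableEquality)
open import Relation.Binary.PropositionalEquality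
  using (_≡_; _≗_; refl; sym; trans; cong; subst; module ≡-Reasoning)
open import Relation.Nullary using (¬_; yes; no; contradiction)
open import Relation.Nullary.Decidable using (¬?; _×-dec_; _⊎-dec_; _→-dec_; ⌊_⌋)
open import Relation.Unary using () renaming (Decidable to Decidable₁)

-- The vertex vᵢ is identified with the index i.  A subset of V × V is a
-- decidable relation.
record Digraph (n : ℕ) : Set₁ where
  field
    Edge  : Rel (Fin n) 0ℓ
    edge? : Decidable Edge

open Digraph public

complement : {n : ℕ} → Digraph n → Digraph n
complement X .Edge  u v = ¬ Edge X u v
complement X .edge? u v = ¬? (edge? X u v)

ℙ : Set
ℙ = [ k ∈ ℕ ∣ NonZero k ]

infix 4 _≟ᵖ_
_≟ᵖ_ : DecidableEquality ℙ
_≟ᵖ_ = refinement-≟ ℕ._≟_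

-- A series is its family of coefficients; the word i₁ ∷ … ∷ iₘ ∷ []
-- stands for the monomial x_{i₁} ⋯ x_{iₘ}.
Series : Set
Series = List ℙ → ℤ

infix  4 _≈ˢ_
infixl 6 _+ˢ_
infixr 7 _·ˢ_

_≈ˢ_ : Rel Series 0ℓ
_≈ˢ_ = _≗_

0ˢ : Series
0ˢ w = 0ℤ

_+ˢ_ : Series → Series → Series
(F +ˢ G) w = F w +ᶻ G w

_·ˢ_ : ℤ → Series → Series
(c ·ˢ F) w = c *ᶻ F w

∑ : {A : Set} → List A → (A → Series) → Series
∑ xs F = foldr (λ x G → F x +ˢ G) 0ˢ xs

-- The formal sum of a(i) x_{i(1)} ⋯ x_{i(n)} over all maps i : [n] → ℙ.
-- A word of length n is the monomial of exactly one such map, and a word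
-- of any other length of none, so this needs no infinite summation.
∑-monomials : {n : ℕ} → ((Fin n → ℙ) → ℤ) → Series
∑-monomials {n} a w with length w ℕ.≟ n
... | yes refl = a (lookup w)
... | no  _    = 0ℤ

-- Every bijection [n] → [n] occurs exactly once up to pointwise equality, by
-- permutations-complete and permutations-distinct.  For V = [n] these are both
-- the V-listings and the elements of the symmetric group on V.
permutations : (n : ℕ) → List (Permutation′ n)
permutations zero    = [ id ]
permutations (suc n) = concatMap (λ i → map (insert zero i) (permutations n)) (allFin (suc n))

private
  insert-cong : {n : ℕ} (i : Fin (suc n)) {π ρ : Permutation′ n} → π ≈ ρ →
                insert zero i π ≈ insert zero i ρ
  insert-cong i         e zero    = refl
  insert-cong i {π} {ρ} e (suc k) = begin
    insert zero i π ⟨$⟩ʳ suc k ≡⟨ insert-punchIn zero i π k ⟩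
    punchIn i (π ⟨$⟩ʳ k)       ≡⟨ cong (punchIn i) (e k) ⟩
    punchIn i (ρ ⟨$⟩ʳ k)       ≡⟨ insert-punchIn zero i ρ k ⟨
    insert zero i ρ ⟨$⟩ʳ suc k ∎
    where open ≡-Reasoning

  insert-injective : {n : ℕ} (i : Fin (suc n)) {π ρ : Permutation′ n} →
                     insert zero i π ≈ insert zero i ρ → π ≈ ρ
  insert-injective i {π} {ρ} e k = punchIn-injective i _ _ (begin
    punchIn i (π ⟨$⟩ʳ k)       ≡⟨ insert-punchIn zero i π k ⟨
    insert zero i π ⟨$⟩ʳ suc k ≡⟨ e (suc k) ⟩
    insert zero i ρ ⟨$⟩ʳ suc k ≡⟨ insert-punchIn zero i ρ k ⟩
    punchIn i (ρ ⟨$⟩ʳ k)       ∎)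
    where open ≡-Reasoning

permutations-complete : {n : ℕ} (π : Permutation′ n) → Any (π ≈_) (permutations n)
permutations-complete {zero}  π = here (λ ())
permutations-complete {suc n} π =
  Anyₚ.concat⁺ (Anyₚ.map⁺ (Any.map step (∈-allFin (π ⟨$⟩ʳ zero))))
  where
  step : ∀ {i} → π ⟨$⟩ʳ zero ≡ i → Any (π ≈_) (map (insert zero i) (permutations n))
  step refl = Anyₚ.map⁺ (Any.map
    (λ {ρ} e k → trans (sym (insert-remove zero π k)) (insert-cong _ {remove zero π} {ρ} e k))
    (permutations-complete (remove zero π)))

permutations-distinct : (n : ℕ) → AllPairs (λ π ρ → ¬ π ≈ ρ) (permutations n)
permutations-distinct zero    = [] ∷ []
permutations-distinct (suc n) = AllPairsₚ.concat⁺
  (Allₚ.map⁺ (All.universal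
    (λ i → AllPairsₚ.map⁺ (AllPairs.map (λ {π} {ρ} π≉ρ → π≉ρ ∘ insert-injective i {π} {ρ}) (permutations-distinct n)))
    _))
  (AllPairsₚ.map⁺ (AllPairs.map
    (λ i≢j → Allₚ.map⁺ (All.universal (λ π → Allₚ.map⁺ (All.universal (λ ρ e → i≢j (e zero)) _)) _))
    (allFin⁺ (suc n))))

Friendly : {n : ℕ} → (Fin n → ℙ) → Digraph n → Permutation′ n → Set
Friendly f X σ =
    Linked (λ u v → value (f u) ℕ.≤ value (f v)) listing
  × Linked (λ u v → Edge X u v → value (f u) ℕ.< value (f v)) listing
  where listing = tabulate (σ ⟨$⟩ʳ_)

friendly? : {n : ℕ} (f : Fin n → ℙ) (X : Digraph n) → Decidable₁ (Friendly f X)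
friendly? f X σ =
        linked? (λ u v → value (f u) ℕ.≤? value (f v)) _
  ×-dec linked? (λ u v → edge? X u v →-dec value (f u) ℕ.<? value (f v)) _

#Friendly : {n : ℕ} → (Fin n → ℙ) → Digraph n → ℕ
#Friendly {n} f X = length (filter (friendly? f X) (permutations n))

W : {n : ℕ} → Digraph n → Series
W X = ∑-monomials (λ f → + #Friendly f X)

module _ {n : ℕ} (σ : Permutation′ n) where

  -- v, σ v, σ² v, … , stopping before the first return to v, which happens
  -- within n steps (CycleProperties.period).
  cycleFrom : Fin n → List⁺ (Fin n)
  cycleFrom v = v ∷ takeWhile (λ u → ¬? (u Fin.≟ v)) (iterate (σ ⟨$⟩ʳ_) (σ ⟨$⟩ʳ v) n)

  underlying : Fin n → List (Fin n)
  underlying v = List⁺.toList (cycleFrom v)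

  Leader : Fin n → Set
  Leader v = All (v ≤ᶠ_) (underlying v)

  leader? : Decidable₁ Leader
  leader? v = All.all? (v Fin.≤?_) (underlying v)

  leaders : List (Fin n)
  leaders = filter leader? (allFin n)

  -- Each cycle is listed once, written with its least element first.
  cycles : List (List⁺ (Fin n))
  cycles = map cycleFrom leaders

IsCycleOf : {n : ℕ} → Digraph n → List⁺ (Fin n) → Set
IsCycleOf X (c ∷ cs) = Linked (Edge X) ((c ∷ cs) ∷ʳ c)

isCycleOf? : {n : ℕ} (X : Digraph n) → Decidable₁ (IsCycleOf X)
isCycleOf? X (c ∷ cs) = linked? (edge? X) ((c ∷ cs) ∷ʳ c)

In𝕊 : {n : ℕ} → Digraph n → Permutation′ n → Set
In𝕊 X σ = All (λ γ → IsCycleOf X γ ⊎ IsCycleOf (complement X) γ) (cycles σ)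

in𝕊? : {n : ℕ} (X : Digraph n) → Decidable₁ (In𝕊 X)
in𝕊? X σ = All.all? (λ γ → isCycleOf? X γ ⊎-dec isCycleOf? (complement X) γ) (cycles σ)

𝕊 : {n : ℕ} → Digraph n → List (Permutation′ n)
𝕊 {n} X = filter (in𝕊? X) (permutations n)

φ : {n : ℕ} → Digraph n → Permutation′ n → ℕ
φ X σ = sum (map (λ γ → List⁺.length γ ∸ 1) (filter (isCycleOf? X) (cycles σ)))

record SetPartition (n : ℕ) : Set where
  field
    blocks   : List (Subset n)
    nonempty : All Nonempty blocks
    disjoint : AllPairs (λ B C → ∀ i → i ∈ B → ¬ i ∈ C) blocks
    cover    : ∀ i → Any (i ∈_) blocks

open SetPartition public

ConstantOnBlocks : {n : ℕ} → SetPartition n → (Fin n → ℙ) → Set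
ConstantOnBlocks π i = All (λ B → ∀ j k → j ∈ B → k ∈ B → i j ≡ i k) (blocks π)

constantOnBlocks? : {n : ℕ} (π : SetPartition n) → Decidable₁ (ConstantOnBlocks π)
constantOnBlocks? π i = All.all?
  (λ B → Fin.all? λ j → Fin.all? λ k → j ∈? B →-dec k ∈? B →-dec i j ≟ᵖ i k)
  (blocks π)

p : {n : ℕ} → SetPartition n → Series
p π = ∑-monomials (λ i → if ⌊ constantOnBlocks? π i ⌋ then 1ℤ else 0ℤ)

support : {n : ℕ} → List⁺ (Fin n) → Subset n
support γ = ⋃ (map ⁅_⁆ (List⁺.toList γ))

∈-⋃⁺ : {n : ℕ} {x : Fin n} {xs : List (Fin n)} → x ∈ˡ xs → x ∈ ⋃ (map ⁅_⁆ xs)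
∈-⋃⁺ (here refl) = x∈p∪q⁺ (inj₁ (x∈⁅x⁆ _))
∈-⋃⁺ (there x∈)  = x∈p∪q⁺ (inj₂ (∈-⋃⁺ x∈))

∈-⋃⁻ : {n : ℕ} {x : Fin n} (xs : List (Fin n)) → x ∈ ⋃ (map ⁅_⁆ xs) → x ∈ˡ xs
∈-⋃⁻ []       x∈ = contradiction x∈ ∉⊥
∈-⋃⁻ (y ∷ ys) x∈ with x∈p∪q⁻ ⁅ y ⁆ (⋃ (map ⁅_⁆ ys)) x∈
... | inj₁ x∈y  = here (x∈⁅y⁆⇒x≡y y x∈y)
... | inj₂ x∈ys = there (∈-⋃⁻ ys x∈ys)

module CycleProperties {n : ℕ} (σ : Permutation′ n) where

  power : ℕ → Fin n → Fin n
  power zero    v = v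
  power (suc k) v = σ ⟨$⟩ʳ power k v

  power-+ : ∀ j k v → power (j ℕ.+ k) v ≡ power j (power k v)
  power-+ zero    k v = refl
  power-+ (suc j) k v = cong (σ ⟨$⟩ʳ_) (power-+ j k v)

  power-injective : ∀ k {u v} → power k u ≡ power k v → u ≡ v
  power-injective zero    e = e
  power-injective (suc k) e = power-injective k (Injection.injective (↔⇒↣ σ) e)

  private
    power-suc : ∀ k v → power k (σ ⟨$⟩ʳ v) ≡ power (suc k) v
    power-suc zero    v = refl
    power-suc (suc k) v = cong (σ ⟨$⟩ʳ_) (power-suc k v)

    until : Fin n → ℕ → Fin n → List (Fin n)
    until v m x = takeWhile (λ u → ¬? (u Fin.≟ v)) (iterate (σ ⟨$⟩ʳ_) x m)

    until⇒power : ∀ v m x {u} → u ∈ˡ until v m x → ∃ λ k → u ≡ power k x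
    until⇒power v (suc m) x u∈ with x Fin.≟ v
    until⇒power v (suc m) x ()         | yes _
    until⇒power v (suc m) x (here eq)  | no _ = 0 , eq
    until⇒power v (suc m) x (there u∈) | no _ with until⇒power v m (σ ⟨$⟩ʳ x) u∈
    ... | k , eq = suc k , trans eq (power-suc k x)

    until-head : ∀ v m x j → j ℕ.< m → x ≡ v ⊎ x ∈ˡ until v m x
    until-head v (suc m) x j _ with x Fin.≟ v
    ... | yes x≡v = inj₁ x≡v
    ... | no  _   = inj₂ (here refl)

    until-closed : ∀ v m x j → j ℕ.< m → power j x ≡ v →
                   ∀ {u} → u ∈ˡ until v m x → σ ⟨$⟩ʳ u ≡ v ⊎ σ ⟨$⟩ʳ u ∈ˡ until v m x
    until-closed v (suc m) x j j<m e u∈ with x Fin.≟ v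
    until-closed v (suc m) x j       j<m e ()          | yes _
    until-closed v (suc m) x zero    j<m e u∈          | no x≢v = contradiction e x≢v
    until-closed v (suc m) x (suc j) j<m e (here refl) | no _
      with until-head v m (σ ⟨$⟩ʳ x) j (ℕ.s≤s⁻¹ j<m)
    ... | inj₁ eq = inj₁ eq
    ... | inj₂ q  = inj₂ (there q)
    until-closed v (suc m) x (suc j) j<m e (there u∈)  | no _
      with until-closed v m (σ ⟨$⟩ʳ x) j (ℕ.s≤s⁻¹ j<m) (trans (power-suc j x) e) u∈
    ... | inj₁ eq = inj₁ eq
    ... | inj₂ q  = inj₂ (there q)

  period : ∀ v → ∃ λ k → k ℕ.< n × power (suc k) v ≡ v
  period v with pigeonhole (ℕ.n<1+n n) (λ i → power (toℕ i) v)
  ... | i , j , i<j , e with ℕ.m≤n⇒∃[o]m+o≡n i<j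
  ... | k , 1+i+k≡j = k , k<n , sym (power-injective (toℕ i) (begin
    power (toℕ i) v                 ≡⟨ e ⟩
    power (toℕ j) v                 ≡⟨ cong (λ m → power m v) i+1+k≡j ⟨
    power (toℕ i ℕ.+ suc k) v       ≡⟨ power-+ (toℕ i) (suc k) v ⟩
    power (toℕ i) (power (suc k) v) ∎))
    where
    open ≡-Reasoning
    i+1+k≡j : toℕ i ℕ.+ suc k ≡ toℕ j
    i+1+k≡j = trans (ℕ.+-suc (toℕ i) k) 1+i+k≡j
    k<n : k ℕ.< n
    k<n = ℕ.≤-trans (ℕ.m≤n+m (suc k) (toℕ i))
            (ℕ.≤-trans (ℕ.≤-reflexive i+1+k≡j) (Fin.toℕ≤pred[n] j))

  ∈⇒power : ∀ {u v} → u ∈ˡ underlying σ v → ∃ λ k → u ≡ power k v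
  ∈⇒power (here eq) = 0 , eq
  ∈⇒power {v = v} (there u∈) with until⇒power v n (σ ⟨$⟩ʳ v) u∈
  ... | k , eq = suc k , trans eq (power-suc k v)

  power⇒∈ : ∀ k v → power k v ∈ˡ underlying σ v
  power⇒∈ zero    v = here refl
  power⇒∈ (suc k) v with period v
  ... | j , j<n , e = close (power⇒∈ k v)
    where
    close : ∀ {u} → u ∈ˡ underlying σ v → σ ⟨$⟩ʳ u ∈ˡ underlying σ v
    close (here refl) with until-head v n (σ ⟨$⟩ʳ v) j j<n
    ... | inj₁ eq = here eq
    ... | inj₂ q  = there q
    close (there u∈) with until-closed v n (σ ⟨$⟩ʳ v) j j<n (trans (power-suc j v) e) u∈
    ... | inj₁ eq = here eq
    ... | inj₂ q  = there q

  ∈-trans : ∀ {u v w} → u ∈ˡ underlying σ v → v ∈ˡ underlying σ w → u ∈ˡ underlying σ w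
  ∈-trans {w = w} u∈ v∈ with ∈⇒power u∈ | ∈⇒power v∈
  ... | j , refl | k , refl = subst (_∈ˡ underlying σ w) (power-+ j k w) (power⇒∈ (j ℕ.+ k) w)

  ∈-sym : ∀ {u v} → u ∈ˡ underlying σ v → v ∈ˡ underlying σ u
  ∈-sym {v = v} u∈ with ∈⇒power u∈
  ... | k , refl = go k
    where
    back : ∀ x → x ∈ˡ underlying σ (σ ⟨$⟩ʳ x)
    back x with period x
    ... | j , _ , e = subst (_∈ˡ underlying σ (σ ⟨$⟩ʳ x)) (trans (power-suc j x) e) (power⇒∈ j (σ ⟨$⟩ʳ x))
    go : ∀ k → v ∈ˡ underlying σ (power k v)
    go zero    = here refl
    go (suc k) = ∈-trans (go k) (back (power k v))

  hasLeader : ∀ v → ∃ λ w → Leader σ w × v ∈ˡ underlying σ w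
  hasLeader v = go v (<-wellFounded v)
    where
    go : ∀ v → Acc _<ᶠ_ v → ∃ λ w → Leader σ w × v ∈ˡ underlying σ w
    go v (acc rec) with leader? σ v
    ... | yes lead = v , lead , here refl
    ... | no ¬lead with find (Allₚ.¬All⇒Any¬ (v Fin.≤?_) _ ¬lead)
    ... | u , u∈ , v≰u with go u (rec (ℕ.≰⇒> v≰u))
    ... | w , lead , u∈w = w , lead , ∈-trans (∈-sym u∈) u∈w

  leader-unique : ∀ {u v x} → Leader σ u → Leader σ v →
                  x ∈ˡ underlying σ u → x ∈ˡ underlying σ v → u ≡ v
  leader-unique lu lv xu xv = Fin.≤-antisym
    (All.lookup lu (∈-trans (∈-sym xv) xu))
    (All.lookup lv (∈-trans (∈-sym xu) xv))

Type : {n : ℕ} → Permutation′ n → SetPartition n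
Type {n} σ = record
  { blocks   = map support (cycles σ)
  ; nonempty = Allₚ.map⁺ (Allₚ.map⁺ (All.universal (λ v → v , ∈-⋃⁺ {xs = underlying σ v} (here refl)) (leaders σ)))
  ; disjoint = AllPairsₚ.map⁺ (AllPairsₚ.map⁺
      (pairs (Allₚ.all-filter (leader? σ) (allFin n)) (filter⁺ (leader? σ) (allFin⁺ n))))
  ; cover    = covered
  }
  where
  open CycleProperties σ

  Disjoint : Rel (Fin n) 0ℓ
  Disjoint u v = ∀ i → i ∈ support (cycleFrom σ u) → ¬ i ∈ support (cycleFrom σ v)

  pairs : ∀ {vs} → All (Leader σ) vs → Unique vs → AllPairs Disjoint vs
  pairs []       []         = []
  pairs (l ∷ ls) (v∉ ∷ uvs) =
    All.zipWith (λ (l′ , v≢w) _ iv iw → v≢w (leader-unique l l′ (∈-⋃⁻ _ iv) (∈-⋃⁻ _ iw))) (ls , v∉)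
    ∷ pairs ls uvs

  covered : ∀ i → Any (i ∈_) (map support (cycles σ))
  covered i with hasLeader i
  ... | v , lead , i∈ = Anyₚ.map⁺ (Anyₚ.map⁺
    (Any.map (λ { refl → ∈-⋃⁺ {xs = underlying σ v} i∈ }) (∈-filter⁺ (leader? σ) (∈-allFin v) lead)))

module Submission where

-- Fix a coloring f and write u → v when v may follow u in a friendly listing,
-- so that friendly listings are Hamiltonian paths.  With e = -1 on the pairs
-- u ↛ v and e = 0 otherwise, b = 1 + e is the indicator of →, and for every
-- matrix e one has
--   ∑ over listings ∏ b(uᵢ, uᵢ₊₁) = ∑ over permutations ∏ over cycles (b(γ) - e(γ)).
-- This follows by splitting off the cycle through the first vertex m: cutting
-- a listing at m leaves a path ending in m and a path out of m, whose first
-- step has the weight 1 + e(m, ·).  An induction on the number of vertices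
-- moves this e to the first step of the path ending in m, which closes it to
-- a cycle, up to the cycles all of whose steps are weighted by e.
-- For the e above, b(γ) - e(γ) is 0 unless γ is a cycle of → or of ↛.  As f is
-- monotone along such a cycle it is constant on it, and γ is then a cycle of
-- the complement of X or of X, respectively, contributing 1 or (-1)^(ℓ(γ)-1).

open import Defs
open import Data.Bool.Base using (if_then_else_)
open import Data.Fin.Base using (Fin; zero; suc; punchIn) renaming (_≤_ to _≤ᶠ_; _<_ to _<ᶠ_)
open import Data.Fin.Permutation using (Permutation′; _⟨$⟩ʳ_; insert; insert-punchIn; _≈_)
import Data.Fin.Properties as Fin
open import Data.Fin.Subset using () renaming (_∈_ to _∈ˢ_)
open import Data.Integer.Base using (ℤ; 0ℤ; 1ℤ; -1ℤ; _+_; _*_; _-_; _^_) renaming (+_ to pos)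
import Data.Integer.Properties as ℤ
open import Data.Integer.Tactic.RingSolver using (solve-∀)
open import Data.List.Base as List
  using (List; []; _∷_; _∷ʳ_; _++_; map; concatMap; length; filter; tabulate; allFin; takeWhile; iterate)
open import Data.List.Membership.Propositional using (_∈_)
open import Data.List.Membership.Propositional.Properties
  using (∈-concatMap⁺; ∈-map⁺; ∈-map⁻; ∈-filter⁺; ∈-allFin; ∈-∃++; ∈-++⁺ˡ)
open import Data.List.Membership.Propositional.Properties.WithK using (unique∧set⇒bag)
open import Data.List.NonEmpty.Base as List⁺ using (List⁺; _∷_)
import Data.List.Properties as List
open import Data.List.Relation.Binary.BagAndSetEquality using (∼bag⇒↭)
open import Data.List.Relation.Binary.Disjoint.Propositional using (Disjoint)
open import Data.List.Relation.Binary.Permutation.Propositional as ↭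
  using (_↭_; prep; swap; ↭-refl; ↭-sym; ↭-trans; ↭-reflexive)
open import Data.List.Relation.Binary.Permutation.Propositional.Properties
  using (drop-∷; shift; ++-identityʳ; ∈-resp-↭; ↭-length; All-resp-↭; ¬x∷xs↭[])
open import Data.List.Relation.Binary.Subset.Propositional using (_⊆_)
open import Data.List.Relation.Unary.All as All using (All; []; _∷_)
import Data.List.Relation.Unary.All.Properties as All
open import Data.List.Relation.Unary.AllPairs as AllPairs using (AllPairs; []; _∷_)
import Data.List.Relation.Unary.AllPairs.Properties as AllPairs
open import Data.List.Relation.Unary.Any as Any using (here; there)
open import Data.List.Relation.Unary.Linked as Linked using (Linked; []; [-]; _∷_)
import Data.List.Relation.Unary.Linked.Properties as Linked
open import Data.List.Relation.Unary.Unique.Propositional using (Unique)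
open import Data.List.Relation.Unary.Unique.Propositional.Properties as Unique using (allFin⁺)
open import Data.Nat.Base as ℕ using (ℕ; zero; suc; s≤s; z≤n)
open import Data.Nat.ListAction using (sum)
import Data.Nat.Properties as ℕ
open import Data.Product.Base using (∃; ∃₂; _×_; _,_; proj₁; proj₂)
open import Data.Refinement using (value)
open import Data.Refinement.Properties using (value-injective)
open import Data.Sum.Base using (_⊎_; inj₁; inj₂)
open import Data.Vec.Base as Vec using (Vec; []; _∷_; toList)
open import Function.Base using (_∘_; id; _on_)
open import Function.Bundles using (mk⇔; Injection)
open import Function.Properties.Inverse using (↔⇒↣)
open import Relation.Binary.Definitions using (Decidable; Transitive)
open import Relation.Binary.PropositionalEquality
open import Relation.Nullary using (¬_; yes; no; contradiction)
open import Relation.Nullary.Decidable using (¬?; ⌊_⌋; _×-dec_; _→-dec_)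
open import Relation.Unary using () renaming (Decidable to Decidable₁)
open ≡-Reasoning

-- Finite sums and products of integers.

∑ᶻ : {A : Set} → List A → (A → ℤ) → ℤ
∑ᶻ []       F = 0ℤ
∑ᶻ (x ∷ xs) F = F x + ∑ᶻ xs F

∏ᶻ : {A : Set} → List A → (A → ℤ) → ℤ
∏ᶻ []       F = 1ℤ
∏ᶻ (x ∷ xs) F = F x * ∏ᶻ xs F

module _ {A : Set} where

  ∑ᶻ-cong-All : {F G : A → ℤ} {xs : List A} → All (λ x → F x ≡ G x) xs → ∑ᶻ xs F ≡ ∑ᶻ xs G
  ∑ᶻ-cong-All []       = refl
  ∑ᶻ-cong-All (e ∷ es) = cong₂ _+_ e (∑ᶻ-cong-All es)

  ∑ᶻ-cong : {F G : A → ℤ} (xs : List A) → F ≗ G → ∑ᶻ xs F ≡ ∑ᶻ xs G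
  ∑ᶻ-cong xs F≗G = ∑ᶻ-cong-All (All.universal F≗G xs)

  ∑ᶻ-+ : (F G : A → ℤ) (xs : List A) → ∑ᶻ xs (λ x → F x + G x) ≡ ∑ᶻ xs F + ∑ᶻ xs G
  ∑ᶻ-+ F G []       = refl
  ∑ᶻ-+ F G (x ∷ xs) = trans (cong (F x + G x +_) (∑ᶻ-+ F G xs)) (lemma (F x) (G x) (∑ᶻ xs F) (∑ᶻ xs G))
    where
    lemma : ∀ a b c d → a + b + (c + d) ≡ a + c + (b + d)
    lemma = solve-∀

  ∑ᶻ-*ˡ : (c : ℤ) (F : A → ℤ) (xs : List A) → ∑ᶻ xs (λ x → c * F x) ≡ c * ∑ᶻ xs F
  ∑ᶻ-*ˡ c F []       = sym (ℤ.*-zeroʳ c)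
  ∑ᶻ-*ˡ c F (x ∷ xs) = trans (cong (c * F x +_) (∑ᶻ-*ˡ c F xs)) (sym (ℤ.*-distribˡ-+ c (F x) _))

  ∑ᶻ-0 : (xs : List A) → ∑ᶻ xs (λ _ → 0ℤ) ≡ 0ℤ
  ∑ᶻ-0 []       = refl
  ∑ᶻ-0 (x ∷ xs) = trans (ℤ.+-identityˡ _) (∑ᶻ-0 xs)

  ∑ᶻ-1 : (xs : List A) → ∑ᶻ xs (λ _ → 1ℤ) ≡ pos (length xs)
  ∑ᶻ-1 []       = refl
  ∑ᶻ-1 (x ∷ xs) = cong (_+_ 1ℤ) (∑ᶻ-1 xs)

  ∑ᶻ-++ : (F : A → ℤ) (xs ys : List A) → ∑ᶻ (xs ++ ys) F ≡ ∑ᶻ xs F + ∑ᶻ ys F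
  ∑ᶻ-++ F []       ys = sym (ℤ.+-identityˡ _)
  ∑ᶻ-++ F (x ∷ xs) ys = trans (cong (F x +_) (∑ᶻ-++ F xs ys)) (sym (ℤ.+-assoc (F x) _ _))

  ∑ᶻ-map : {B : Set} (F : A → ℤ) (h : B → A) (xs : List B) → ∑ᶻ (map h xs) F ≡ ∑ᶻ xs (F ∘ h)
  ∑ᶻ-map F h []       = refl
  ∑ᶻ-map F h (x ∷ xs) = cong (F (h x) +_) (∑ᶻ-map F h xs)

  ∑ᶻ-concatMap : {B : Set} (F : A → ℤ) (h : B → List A) (xs : List B) →
                 ∑ᶻ (concatMap h xs) F ≡ ∑ᶻ xs (λ x → ∑ᶻ (h x) F)
  ∑ᶻ-concatMap F h []       = refl
  ∑ᶻ-concatMap F h (x ∷ xs) = trans (∑ᶻ-++ F (h x) _) (cong (_+_ (∑ᶻ (h x) F)) (∑ᶻ-concatMap F h xs))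

-- Drawing entries from a vector.

module _ {A : Set} where

  picks : ∀ {k} → Vec A (suc k) → List (A × Vec A k)
  picks (x ∷ [])    = (x , []) ∷ []
  picks (x ∷ y ∷ U) = (x , y ∷ U) ∷ map (λ (u , V) → u , x ∷ V) (picks (y ∷ U))

  picks-∷ : ∀ {k} (x : A) (U : Vec A (suc k)) (F : A × Vec A (suc k) → ℤ) →
            ∑ᶻ (picks (x ∷ U)) F ≡ F (x , U) + ∑ᶻ (picks U) (λ (u , V) → F (u , x ∷ V))
  picks-∷ x (y ∷ U) F = cong (F (x , y ∷ U) +_) (∑ᶻ-map F _ (picks (y ∷ U)))

  -- Two successive draws produce each ordered pair of positions once, and the remainder keeps the
  -- order of `U`, so it is the same for both orders of drawing.
  picks-swap : ∀ {k} (U : Vec A (suc (suc k))) (F : A → A → Vec A k → ℤ) →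
               ∑ᶻ (picks U) (λ (u , V) → ∑ᶻ (picks V) (λ (v , R) → F u v R)) ≡
               ∑ᶻ (picks U) (λ (u , V) → ∑ᶻ (picks V) (λ (v , R) → F v u R))
  picks-swap (x ∷ y ∷ []) F = lemma (F x y []) (F y x [])
    where
    lemma : ∀ a b → (a + 0ℤ) + ((b + 0ℤ) + 0ℤ) ≡ (b + 0ℤ) + ((a + 0ℤ) + 0ℤ)
    lemma = solve-∀
  picks-swap {suc k} (x ∷ U) F = begin
    -- In `L` the entry `x` is drawn first, in `R` second. Reversing the arguments of `F`
    -- interchanges the two.
    S (x ∷ U) F                                   ≡⟨ expand F ⟩
    L + (R + S U (λ u v V → F u v (x ∷ V)))       ≡⟨ cong (λ s → L + (R + s)) (picks-swap U _) ⟩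
    L + (R + S U (λ u v V → F v u (x ∷ V)))       ≡⟨ lemma L R _ ⟩
    R + (L + S U (λ u v V → F v u (x ∷ V)))       ≡⟨ expand (λ u v → F v u) ⟨
    S (x ∷ U) (λ u v → F v u)                     ∎
    where
    S : ∀ {j} → Vec A (suc (suc j)) → (A → A → Vec A j → ℤ) → ℤ
    S U F = ∑ᶻ (picks U) (λ (u , V) → ∑ᶻ (picks V) (λ (v , R) → F u v R))
    L = ∑ᶻ (picks U) (λ (v , R) → F x v R)
    R = ∑ᶻ (picks U) (λ (v , R) → F v x R)
    lemma : ∀ a b c → a + (b + c) ≡ b + (a + c)
    lemma = solve-∀
    expand : ∀ F → S (x ∷ U) F ≡ ∑ᶻ (picks U) (λ (v , R) → F x v R) +
             (∑ᶻ (picks U) (λ (v , R) → F v x R) + S U (λ u v V → F u v (x ∷ V)))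
    expand F = begin
      S (x ∷ U) F
        ≡⟨ picks-∷ x U _ ⟩
      l + ∑ᶻ (picks U) (λ (u , V) → ∑ᶻ (picks (x ∷ V)) (λ (v , R) → F u v R))
        ≡⟨ cong (_+_ l) (∑ᶻ-cong (picks U) (λ (u , V) → picks-∷ x V _)) ⟩
      l + ∑ᶻ (picks U) (λ (u , V) → F u x V + ∑ᶻ (picks V) (λ (v , R) → F u v (x ∷ R)))
        ≡⟨ cong (_+_ l) (∑ᶻ-+ _ _ (picks U)) ⟩
      l + (∑ᶻ (picks U) (λ (u , V) → F u x V) + S U (λ u v V → F u v (x ∷ V))) ∎
      where l = ∑ᶻ (picks U) (λ (v , R) → F x v R)

  -- The entries split off come in every order, the remaining ones keep theirs.
  splits : ∀ {k} → Vec A k → List (List A × ∃ (Vec A))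
  splits {zero}  U = ([] , zero , U) ∷ []
  splits {suc k} U = ([] , suc k , U) ∷
    concatMap (λ (u , V) → map (λ (w , R) → u ∷ w , R) (splits V)) (picks U)

  splits-≤ : ∀ {k} (U : Vec A k) → All (λ (_ , j , _) → j ℕ.≤ k) (splits U)
  splits-≤ {zero}  U = z≤n ∷ []
  splits-≤ {suc k} U = ℕ.≤-refl ∷ All.concat⁺ (All.map⁺ (All.universal
    (λ (u , V) → All.map⁺ (All.map ℕ.m≤n⇒m≤1+n (splits-≤ V))) (picks U)))

-- Weights of walks and paths.

module _ {A : Set} where

  Weight : Set
  Weight = A → A → ℤ

  -- A walk to m whose first step, to its first vertex, has the weight r.
  walk : Weight → (A → ℤ) → List A → A → ℤ
  walk b r []      m = r m
  walk b r (u ∷ w) m = r u * walk b (b u) w m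

  path : Weight → (A → ℤ) → List A → ℤ
  path b r []      = 1ℤ
  path b r (u ∷ w) = r u * path b (b u) w

  -- This is the sum of `path b r` over all listings of the entries of `U`.
  paths : Weight → (A → ℤ) → ∀ {k} → Vec A k → ℤ
  paths b r {zero}  U = 1ℤ
  paths b r {suc k} U = ∑ᶻ (picks U) (λ (u , V) → r u * paths b (b u) V)

  -- This is the sum over all ways to take a walk to `m` out of `U`, with the remainder weighted by
  -- `g`. The recursion suits the induction in `walks-exchange`; `walks-splits` gives the explicit
  -- sum, from which linearity in `g` is read off.
  walks : Weight → (A → ℤ) → A → (∀ {k} → Vec A k → ℤ) → ∀ {k} → Vec A k → ℤ
  walks b r m g {zero}  U = r m * g U
  walks b r m g {suc k} U = r m * g U + ∑ᶻ (picks U) (λ (u , V) → r u * walks b (b u) m g V)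

  walks-splits : ∀ b r m (g : ∀ {k} → Vec A k → ℤ) {k} (U : Vec A k) →
                 walks b r m g U ≡ ∑ᶻ (splits U) (λ (w , _ , R) → walk b r w m * g R)
  walks-splits b r m g {zero}  U = sym (ℤ.+-identityʳ _)
  walks-splits b r m g {suc k} U = cong (r m * g U +_) (begin
    ∑ᶻ (picks U) (λ (u , V) → r u * walks b (b u) m g V)
      ≡⟨ ∑ᶻ-cong (picks U) (λ (u , V) → begin
           r u * walks b (b u) m g V
             ≡⟨ cong (r u *_) (walks-splits b (b u) m g V) ⟩
           r u * ∑ᶻ (splits V) (λ (w , _ , R) → walk b (b u) w m * g R)
             ≡⟨ ∑ᶻ-*ˡ (r u) _ (splits V) ⟨
           ∑ᶻ (splits V) (λ (w , _ , R) → r u * (walk b (b u) w m * g R))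
             ≡⟨ ∑ᶻ-cong (splits V) (λ (w , _ , R) → ℤ.*-assoc (r u) _ _) ⟨
           ∑ᶻ (splits V) (λ (w , _ , R) → r u * walk b (b u) w m * g R)
             ≡⟨ ∑ᶻ-map _ _ (splits V) ⟨
           ∑ᶻ (map (λ (w , R) → u ∷ w , R) (splits V)) (λ (w , _ , R) → walk b r w m * g R) ∎) ⟩
    ∑ᶻ (picks U) (λ (u , V) → ∑ᶻ (map (λ (w , R) → u ∷ w , R) (splits V)) (λ (w , _ , R) → walk b r w m * g R))
      ≡⟨ ∑ᶻ-concatMap _ _ (picks U) ⟨
    ∑ᶻ (concatMap (λ (u , V) → map (λ (w , R) → u ∷ w , R) (splits V)) (picks U))
       (λ (w , _ , R) → walk b r w m * g R) ∎)

  walks-+ˡ : ∀ b {r s t : A → ℤ} → (∀ u → t u ≡ r u + s u) → ∀ m (g : ∀ {k} → Vec A k → ℤ) {k} (U : Vec A k) →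
             walks b t m g U ≡ walks b r m g U + walks b s m g U
  walks-+ˡ b {r} {s} {t} e m g {zero}  U =
    trans (cong (_* g U) (e m)) (ℤ.*-distribʳ-+ (g U) (r m) (s m))
  walks-+ˡ b {r} {s} {t} e m g {suc k} U = begin
    t m * g U + ∑ᶻ (picks U) (λ (u , V) → t u * F u V)
      ≡⟨ cong₂ _+_ (trans (cong (_* g U) (e m)) (ℤ.*-distribʳ-+ (g U) (r m) (s m)))
           (trans (∑ᶻ-cong (picks U) (λ (u , V) → trans (cong (_* F u V) (e u)) (ℤ.*-distribʳ-+ (F u V) (r u) (s u))))
                  (∑ᶻ-+ _ _ (picks U))) ⟩
    (r m * g U + s m * g U) + (∑ᶻ (picks U) (λ (u , V) → r u * F u V) + ∑ᶻ (picks U) (λ (u , V) → s u * F u V))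
      ≡⟨ lemma (r m * g U) _ _ _ ⟩
    (r m * g U + ∑ᶻ (picks U) (λ (u , V) → r u * F u V)) + (s m * g U + ∑ᶻ (picks U) (λ (u , V) → s u * F u V)) ∎
    where
    F : A → Vec A k → ℤ
    F u V = walks b (b u) m g V
    lemma : ∀ a b c d → (a + b) + (c + d) ≡ (a + c) + (b + d)
    lemma = solve-∀

  module _ (b : Weight) (r : A → ℤ) (m : A) {k : ℕ} (U : Vec A k) where
    private
      term : List A → ℤ
      term w = walk b r w m

    walks-cong : {g h : ∀ {k} → Vec A k → ℤ} → (∀ {j} (V : Vec A j) → g V ≡ h V) →
                 walks b r m g U ≡ walks b r m h U
    walks-cong {g} {h} e = begin
      walks b r m g U                             ≡⟨ walks-splits b r m g U ⟩
      ∑ᶻ (splits U) (λ (w , _ , R) → term w * g R) ≡⟨ ∑ᶻ-cong (splits U) (λ (w , _ , R) → cong (term w *_) (e R)) ⟩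
      ∑ᶻ (splits U) (λ (w , _ , R) → term w * h R) ≡⟨ walks-splits b r m h U ⟨
      walks b r m h U                             ∎

    walks-+ʳ : (g h : ∀ {k} → Vec A k → ℤ) →
               walks b r m (λ V → g V + h V) U ≡ walks b r m g U + walks b r m h U
    walks-+ʳ g h = begin
      walks b r m (λ V → g V + h V) U
        ≡⟨ walks-splits b r m (λ V → g V + h V) U ⟩
      ∑ᶻ (splits U) (λ (w , _ , R) → term w * (g R + h R))
        ≡⟨ trans (∑ᶻ-cong (splits U) (λ (w , _ , R) → ℤ.*-distribˡ-+ (term w) (g R) (h R))) (∑ᶻ-+ _ _ (splits U)) ⟩
      ∑ᶻ (splits U) (λ (w , _ , R) → term w * g R) + ∑ᶻ (splits U) (λ (w , _ , R) → term w * h R)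
        ≡⟨ cong₂ _+_ (walks-splits b r m g U) (walks-splits b r m h U) ⟨
      walks b r m g U + walks b r m h U ∎

    walks-* : (c : ℤ) (g : ∀ {k} → Vec A k → ℤ) → walks b r m (λ V → c * g V) U ≡ c * walks b r m g U
    walks-* c g = begin
      walks b r m (λ V → c * g V) U
        ≡⟨ walks-splits b r m (λ V → c * g V) U ⟩
      ∑ᶻ (splits U) (λ (w , _ , R) → term w * (c * g R))
        ≡⟨ trans (∑ᶻ-cong (splits U) (λ (w , _ , R) → lemma (term w) c (g R))) (∑ᶻ-*ˡ c _ (splits U)) ⟩
      c * ∑ᶻ (splits U) (λ (w , _ , R) → term w * g R)
        ≡⟨ cong (c *_) (walks-splits b r m g U) ⟨
      c * walks b r m g U ∎
      where
      lemma : ∀ a b c → a * (b * c) ≡ b * (a * c)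
      lemma = solve-∀

  -- The value 0 on the empty vector gives a function on vectors of every length, as the argument
  -- `g` of `walks` has to be.
  ∑pick : ∀ {k} → (A → ∀ {j} → Vec A j → ℤ) → Vec A k → ℤ
  ∑pick {zero}  F U = 0ℤ
  ∑pick {suc k} F U = ∑ᶻ (picks U) (λ (u , V) → F u V)

  -- The entry `u` drawn from what a walk leaves over may as well be drawn before the walk starts:
  -- `picks-swap` moves it past each vertex of the walk in turn.
  walks-∑pick : ∀ b r m (F : A → ∀ {j} → Vec A j → ℤ) {k} (U : Vec A k) →
                walks b r m (∑pick F) U ≡ ∑pick (λ u → walks b r m (F u)) U
  walks-∑pick b r m F {zero}  U = ℤ.*-zeroʳ (r m)
  -- `picks-swap` needs two entries. With a single one, a walk through it leaves nothing to draw,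
  -- and its term vanishes.
  walks-∑pick b r m F {suc zero} U = begin
    r m * ∑ᶻ (picks U) (λ (u , V) → F u V) + ∑ᶻ (picks U) (λ (u , V) → r u * (b u m * 0ℤ))
      ≡⟨ cong₂ _+_ (sym (∑ᶻ-*ˡ (r m) _ (picks U)))
           (trans (∑ᶻ-cong (picks U) (λ (u , V) → lemma (r u) (b u m))) (∑ᶻ-0 (picks U))) ⟩
    ∑ᶻ (picks U) (λ (u , V) → r m * F u V) + 0ℤ
      ≡⟨ ℤ.+-identityʳ _ ⟩
    ∑ᶻ (picks U) (λ (u , V) → r m * F u V) ∎
    where
    lemma : ∀ a b → a * (b * 0ℤ) ≡ 0ℤ
    lemma = solve-∀
  walks-∑pick b r m F {suc (suc k)} U = begin
    r m * ∑ᶻ (picks U) (λ (u , V) → F u V) + ∑ᶻ (picks U) (λ (v , V) → r v * walks b (b v) m (∑pick F) V)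
      ≡⟨ cong₂ _+_ (sym (∑ᶻ-*ˡ (r m) _ (picks U)))
           (∑ᶻ-cong (picks U) (λ (v , V) →
             trans (cong (r v *_) (walks-∑pick b (b v) m F V)) (sym (∑ᶻ-*ˡ (r v) _ (picks V))))) ⟩
    ∑ᶻ (picks U) (λ (u , V) → r m * F u V) +
    ∑ᶻ (picks U) (λ (v , V) → ∑ᶻ (picks V) (λ (u , R) → r v * walks b (b v) m (F u) R))
      ≡⟨ cong (∑ᶻ (picks U) (λ (u , V) → r m * F u V) +_) (picks-swap U (λ v u R → r v * walks b (b v) m (F u) R)) ⟩
    ∑ᶻ (picks U) (λ (u , V) → r m * F u V) +
    ∑ᶻ (picks U) (λ (u , V) → ∑ᶻ (picks V) (λ (v , R) → r v * walks b (b v) m (F u) R))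
      ≡⟨ ∑ᶻ-+ _ _ (picks U) ⟨
    ∑ᶻ (picks U) (λ (u , V) → r m * F u V + ∑ᶻ (picks V) (λ (v , R) → r v * walks b (b v) m (F u) R)) ∎

  -- Each listing is cut at `m`, into a walk to `m` and a path out of `m`.
  paths-∷ : ∀ b r m {k} (U : Vec A k) → paths b r (m ∷ U) ≡ walks b r m (paths b (b m)) U
  paths-∷ b r m {zero}  []  = ℤ.+-identityʳ _
  paths-∷ b r m {suc k} U = trans (picks-∷ m U _) (cong (_+_ (r m * paths b (b m) U))
    (∑ᶻ-cong (picks U) (λ (u , V) → cong (r u *_) (paths-∷ b (b u) m V))))

-- Closing walks to cycles, for an arbitrary matrix.

module _ {A : Set} (e : Weight {A}) where

  one : A → ℤ
  one _ = 1ℤ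

  1+e : Weight
  1+e u v = 1ℤ + e u v

  paths₁ : ∀ {k} → Vec A k → ℤ
  paths₁ = paths 1+e one

  -- This is the surplus when the weight of the first step is raised from 1 to 1 + `ε`. The empty
  -- path has no first step and contributes nothing.
  paths⁺ : (A → ℤ) → ∀ {k} → Vec A k → ℤ
  paths⁺ ε = ∑pick (λ u V → ε u * paths 1+e (1+e u) V)

  paths-1+ : ∀ ε {k} (U : Vec A k) → paths 1+e (λ u → 1ℤ + ε u) U ≡ paths₁ U + paths⁺ ε U
  paths-1+ ε {zero}  U = refl
  paths-1+ ε {suc k} U = trans (∑ᶻ-cong (picks U) (λ (u , V) → ℤ.*-distribʳ-+ _ 1ℤ (ε u))) (∑ᶻ-+ _ _ (picks U))

  -- In the first sum the path left over by the walk starts at some `u` with the weight `ε u`. By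
  -- `walks-∑pick` this `u` is drawn first, and induction on the remaining entries, corrected by the
  -- walks through `u` in the second sum, yields walks to `m` whose first vertex is `u`. The term
  -- `ε m * paths₁ U` on the right, for the walk without inner vertices, comes from the second sum.
  walks-exchange : ∀ ε m {k} (U : Vec A k) →
    walks 1+e one m (paths⁺ ε) U + walks e ε m paths₁ U ≡ walks 1+e ε m paths₁ U
  -- Expanding 1 + `ε` adds the same sum `O` to both sides of `walks-exchange`. This is the form for
  -- which a row of `1+e` arises as the weight of the first step.
  walks-exchange-step : ∀ ε m {k} (U : Vec A k) →
    walks 1+e one m (paths 1+e (λ u → 1ℤ + ε u)) U + walks e ε m paths₁ U ≡
    walks 1+e (λ u → 1ℤ + ε u) m paths₁ U

  walks-exchange-step ε m U = begin
    walks 1+e one m (paths 1+e (λ u → 1ℤ + ε u)) U + E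
      ≡⟨ cong (_+ E) (trans (walks-cong 1+e one m U (paths-1+ ε)) (walks-+ʳ 1+e one m U paths₁ (paths⁺ ε))) ⟩
    (O + walks 1+e one m (paths⁺ ε) U) + E
      ≡⟨ ℤ.+-assoc O _ E ⟩
    O + (walks 1+e one m (paths⁺ ε) U + E)
      ≡⟨ cong (_+_ O) (walks-exchange ε m U) ⟩
    O + walks 1+e ε m paths₁ U
      ≡⟨ walks-+ˡ 1+e (λ _ → refl) m paths₁ U ⟨
    walks 1+e (λ u → 1ℤ + ε u) m paths₁ U ∎
    where
    O = walks 1+e one m paths₁ U
    E = walks e ε m paths₁ U

  walks-exchange ε m {zero}  U = lemma (ε m)
    where
    lemma : ∀ a → 1ℤ * 0ℤ + a * 1ℤ ≡ a * 1ℤ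
    lemma = solve-∀
  walks-exchange ε m {suc k} U = begin
    walks 1+e one m (paths⁺ ε) U + (ε m * paths₁ U + ∑ᶻ (picks U) (λ (u , V) → ε u * walks e (e u) m paths₁ V))
      ≡⟨ cong (_+ (ε m * paths₁ U + Q)) (trans (walks-∑pick 1+e one m (λ u V → ε u * paths 1+e (1+e u) V) U)
           (∑ᶻ-cong (picks U) (λ (u , V) → walks-* 1+e one m V (ε u) (paths 1+e (1+e u))))) ⟩
    P + (ε m * paths₁ U + Q)
      ≡⟨ lemma P (ε m * paths₁ U) Q ⟩
    ε m * paths₁ U + (P + Q)
      -- The induction takes the row `e u` for `ε`, on the vector `V` without `u`.
      ≡⟨ cong (_+_ (ε m * paths₁ U)) (trans (sym (∑ᶻ-+ _ _ (picks U))) (∑ᶻ-cong (picks U) (λ (u , V) →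
           trans (sym (ℤ.*-distribˡ-+ (ε u) _ _)) (cong (ε u *_) (walks-exchange-step (e u) m V))))) ⟩
    ε m * paths₁ U + ∑ᶻ (picks U) (λ (u , V) → ε u * walks 1+e (1+e u) m paths₁ V) ∎
    where
    P = ∑ᶻ (picks U) (λ (u , V) → ε u * walks 1+e one m (paths 1+e (1+e u)) V)
    Q = ∑ᶻ (picks U) (λ (u , V) → ε u * walks e (e u) m paths₁ V)
    lemma : ∀ a b c → a + (b + c) ≡ b + (a + c)
    lemma = solve-∀

  closedWalk : Weight → List⁺ A → ℤ
  closedWalk b (m ∷ w) = walk b (b m) w m

  cycleWeight : List⁺ A → ℤ
  cycleWeight γ = closedWalk 1+e γ - closedWalk e γ

  -- With the row `e m` as `ε`, the first sum of `walks-exchange-step` consists of the listings cut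
  -- at `m`, while the walks in the other two sums start with a step out of `m` and so are closed.
  -- Solving for the first sum produces the difference in `cycleWeight`.
  paths₁-∷ : ∀ m {k} (U : Vec A k) →
             paths₁ (m ∷ U) ≡ ∑ᶻ (splits U) (λ (w , _ , R) → cycleWeight (m ∷ w) * paths₁ R)
  paths₁-∷ m U = begin
    paths₁ (m ∷ U)
      ≡⟨ paths-∷ 1+e one m U ⟩
    walks 1+e one m (paths 1+e (1+e m)) U
      ≡⟨ lemma _ (walks e (e m) m paths₁ U) ⟩
    (walks 1+e one m (paths 1+e (1+e m)) U + walks e (e m) m paths₁ U) + -1ℤ * walks e (e m) m paths₁ U
      ≡⟨ cong₂ (λ s t → s + -1ℤ * t) (trans (walks-exchange-step (e m) m U) (walks-splits 1+e (1+e m) m paths₁ U))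
           (walks-splits e (e m) m paths₁ U) ⟩
    ∑ᶻ (splits U) (λ (w , _ , R) → B w * paths₁ R) + -1ℤ * ∑ᶻ (splits U) (λ (w , _ , R) → E w * paths₁ R)
      ≡⟨ cong (∑ᶻ (splits U) (λ (w , _ , R) → B w * paths₁ R) +_) (∑ᶻ-*ˡ -1ℤ _ (splits U)) ⟨
    ∑ᶻ (splits U) (λ (w , _ , R) → B w * paths₁ R) + ∑ᶻ (splits U) (λ (w , _ , R) → -1ℤ * (E w * paths₁ R))
      ≡⟨ ∑ᶻ-+ (λ (w , _ , R) → B w * paths₁ R) (λ (w , _ , R) → -1ℤ * (E w * paths₁ R)) (splits U) ⟨
    ∑ᶻ (splits U) (λ (w , _ , R) → B w * paths₁ R + -1ℤ * (E w * paths₁ R))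
      ≡⟨ ∑ᶻ-cong (splits U) (λ (w , _ , R) → distr (B w) (E w) (paths₁ R)) ⟩
    ∑ᶻ (splits U) (λ (w , _ , R) → cycleWeight (m ∷ w) * paths₁ R) ∎
    where
    B E : List A → ℤ
    B w = walk 1+e (1+e m) w m
    E w = walk e (e m) w m
    lemma : ∀ a b → a ≡ (a + b) + -1ℤ * b
    lemma = solve-∀
    distr : ∀ a b c → a * c + -1ℤ * (b * c) ≡ (a - b) * c
    distr = solve-∀

-- Decompositions into cycles.

module _ {A : Set} where

  -- The cycles start with their first entry in U, and the first argument bounds
  -- the number of entries: the value is junk when it is too small.
  decompositions : ℕ → ∀ {k} → Vec A k → List (List (List⁺ A))
  decompositions (suc N) (m ∷ U) =
    concatMap (λ (w , _ , R) → map ((m ∷ w) ∷_) (decompositions N R)) (splits U)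
  decompositions _       _       = [] ∷ []

  -- Iterating `paths₁-∷` splits off one cycle at a time. The remainder may have any smaller length,
  -- so the induction runs on the bound `N`.
  ∑-decompositions : (e : Weight) (N : ℕ) {k : ℕ} → k ℕ.≤ N → (U : Vec A k) →
                     ∑ᶻ (decompositions N U) (λ γs → ∏ᶻ γs (cycleWeight e)) ≡ paths₁ e U
  ∑-decompositions e zero    {zero}  k≤N     U       = refl
  ∑-decompositions e (suc N) {zero}  k≤N     []      = refl
  ∑-decompositions e (suc N) {suc k} (s≤s k≤N) (m ∷ U) = begin
    ∑ᶻ (concatMap (λ (w , _ , R) → map ((m ∷ w) ∷_) (decompositions N R)) (splits U)) weight
      ≡⟨ ∑ᶻ-concatMap weight _ (splits U) ⟩
    ∑ᶻ (splits U) (λ (w , _ , R) → ∑ᶻ (map ((m ∷ w) ∷_) (decompositions N R)) weight)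
      ≡⟨ ∑ᶻ-cong-All (All.map (λ { {w , _ , R} j≤k → begin
           ∑ᶻ (map ((m ∷ w) ∷_) (decompositions N R)) weight
             ≡⟨ ∑ᶻ-map weight _ (decompositions N R) ⟩
           ∑ᶻ (decompositions N R) (λ γs → cycleWeight e (m ∷ w) * weight γs)
             ≡⟨ ∑ᶻ-*ˡ (cycleWeight e (m ∷ w)) weight (decompositions N R) ⟩
           cycleWeight e (m ∷ w) * ∑ᶻ (decompositions N R) weight
             ≡⟨ cong (cycleWeight e (m ∷ w) *_) (∑-decompositions e N (ℕ.≤-trans j≤k k≤N) R) ⟩
           cycleWeight e (m ∷ w) * paths₁ e R ∎ }) (splits-≤ U)) ⟩
    ∑ᶻ (splits U) (λ (w , _ , R) → cycleWeight e (m ∷ w) * paths₁ e R)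
      ≡⟨ paths₁-∷ e m U ⟨
    paths₁ e (m ∷ U) ∎
    where
    weight : List (List⁺ A) → ℤ
    weight γs = ∏ᶻ γs (cycleWeight e)

-- Sums over permutations as sums over paths.

picks-tabulate : ∀ {n} {A : Set} (f : Fin (suc n) → A) (F : A × Vec A n → ℤ) →
  ∑ᶻ (picks (Vec.tabulate f)) F ≡ ∑ᶻ (allFin (suc n)) (λ i → F (f i , Vec.tabulate (f ∘ punchIn i)))
picks-tabulate {zero}  f F = refl
picks-tabulate {suc n} f F = trans (picks-∷ (f zero) (Vec.tabulate (f ∘ suc)) F)
  (cong (F (f zero , Vec.tabulate (f ∘ suc)) +_) (begin
    ∑ᶻ (picks (Vec.tabulate (f ∘ suc))) (λ (u , V) → F (u , f zero ∷ V))
      ≡⟨ picks-tabulate (f ∘ suc) _ ⟩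
    ∑ᶻ (allFin (suc n)) (G ∘ suc)
      ≡⟨ ∑ᶻ-map G suc (allFin (suc n)) ⟨
    ∑ᶻ (map suc (allFin (suc n))) G
      ≡⟨ cong (λ xs → ∑ᶻ xs G) (List.map-tabulate id suc) ⟩
    ∑ᶻ (tabulate suc) G ∎))
  where
  G : Fin (suc (suc n)) → ℤ
  G i = F (f i , Vec.tabulate (f ∘ punchIn i))

-- `insert zero i` lists `i` first and then the listing of `π` carried along `punchIn i`. The
-- labelling `f` is arbitrary so that the induction can absorb `punchIn i`.
∑-permutations : ∀ {n} {A : Set} b r (f : Fin n → A) →
  ∑ᶻ (permutations n) (λ σ → path b r (tabulate (λ i → f (σ ⟨$⟩ʳ i)))) ≡ paths b r (Vec.tabulate f)
∑-permutations {zero}  b r f = refl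
∑-permutations {suc n} b r f = begin
  ∑ᶻ (permutations (suc n)) weight
    ≡⟨ ∑ᶻ-concatMap weight (λ i → map (insert zero i) (permutations n)) (allFin (suc n)) ⟩
  ∑ᶻ (allFin (suc n)) (λ i → ∑ᶻ (map (insert zero i) (permutations n)) weight)
    ≡⟨ ∑ᶻ-cong (allFin (suc n)) (λ i → begin
         ∑ᶻ (map (insert zero i) (permutations n)) weight
           ≡⟨ ∑ᶻ-map weight (insert zero i) (permutations n) ⟩
         ∑ᶻ (permutations n) (weight ∘ insert zero i)
           ≡⟨ ∑ᶻ-cong (permutations n) (λ π → cong (λ xs → r (f i) * path b (b (f i)) xs)
                (List.tabulate-cong (λ k → cong f (insert-punchIn zero i π k)))) ⟩
         ∑ᶻ (permutations n) (λ π → r (f i) * path b (b (f i)) (tabulate (λ k → f (punchIn i (π ⟨$⟩ʳ k)))))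
           ≡⟨ ∑ᶻ-*ˡ (r (f i)) _ (permutations n) ⟩
         r (f i) * ∑ᶻ (permutations n) (λ π → path b (b (f i)) (tabulate (λ k → f (punchIn i (π ⟨$⟩ʳ k)))))
           ≡⟨ cong (r (f i) *_) (∑-permutations b (b (f i)) (f ∘ punchIn i)) ⟩
         r (f i) * paths b (b (f i)) (Vec.tabulate (f ∘ punchIn i)) ∎) ⟩
  ∑ᶻ (allFin (suc n)) (λ i → r (f i) * paths b (b (f i)) (Vec.tabulate (f ∘ punchIn i)))
    ≡⟨ picks-tabulate f _ ⟨
  paths b r (Vec.tabulate f) ∎
  where
  weight : Permutation′ (suc n) → ℤ
  weight σ = path b r (tabulate (λ i → f (σ ⟨$⟩ʳ i)))

-- Rearrangements of lists and membership among the decompositions.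

module _ {A : Set} where

  ∑ᶻ-↭ : (F : A → ℤ) {xs ys : List A} → xs ↭ ys → ∑ᶻ xs F ≡ ∑ᶻ ys F
  ∑ᶻ-↭ F ↭.refl              = refl
  ∑ᶻ-↭ F (prep x xs↭ys)     = cong (F x +_) (∑ᶻ-↭ F xs↭ys)
  ∑ᶻ-↭ F (swap x y xs↭ys)   = trans (cong (λ s → F x + (F y + s)) (∑ᶻ-↭ F xs↭ys)) (lemma (F x) (F y) _)
    where
    lemma : ∀ a b c → a + (b + c) ≡ b + (a + c)
    lemma = solve-∀
  ∑ᶻ-↭ F (↭.trans xs↭ys ys↭zs) = trans (∑ᶻ-↭ F xs↭ys) (∑ᶻ-↭ F ys↭zs)

  unique∧⊆⇒↭++ : {xs ys : List A} → Unique xs → xs ⊆ ys → ∃ λ zs → ys ↭ xs ++ zs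
  unique∧⊆⇒↭++ {ys = ys} [] xs⊆ys = ys , ↭-refl
  unique∧⊆⇒↭++ (x∉xs ∷ uxs) xs⊆ys with ∈-∃++ (xs⊆ys (here refl))
  ... | as , bs , refl with unique∧⊆⇒↭++ uxs (λ y∈xs →
          Any.tail (All.lookup x∉xs y∈xs ∘ sym) (∈-resp-↭ (shift _ as bs) (xs⊆ys (there y∈xs))))
  ... | zs , as++bs↭ = zs , ↭-trans (shift _ as bs) (prep _ as++bs↭)

  -- A nonempty remainder `zs` would make `ys` longer than `xs`.
  unique∧⊆∧length⇒↭ : {xs ys : List A} → Unique xs → xs ⊆ ys → length xs ≡ length ys → xs ↭ ys
  unique∧⊆∧length⇒↭ {xs} {ys} uxs xs⊆ys eq with unique∧⊆⇒↭++ uxs xs⊆ys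
  ... | []     , ys↭ = ↭-sym (↭-trans ys↭ (++-identityʳ xs))
  ... | z ∷ zs , ys↭ =
    contradiction (trans eq (trans (↭-length ys↭) (List.length-++ xs))) λ eq → ℕ.m≢1+m+n _ (trans eq (ℕ.+-suc _ _))

module _ {A : Set} {R : A → A → Set} where

  picks-∈ : ∀ {k} {u : A} (U : Vec A (suc k)) → AllPairs R (toList U) → u ∈ toList U →
            ∃ λ V → (u , V) ∈ picks U × toList U ↭ u ∷ toList V × AllPairs R (toList V)
  picks-∈ (x ∷ [])    _             (here refl) = [] , here refl , ↭-refl , []
  picks-∈ (x ∷ y ∷ U) (_ ∷ sorted)  (here refl) = y ∷ U , here refl , ↭-refl , sorted
  picks-∈ (x ∷ y ∷ U) (x< ∷ sorted) (there u∈) with picks-∈ (y ∷ U) sorted u∈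
  ... | V , uV∈ , U↭ , sortedV =
    x ∷ V , there (∈-map⁺ _ uV∈) , ↭-trans (prep x U↭) (swap x _ ↭-refl) ,
    All.tail (All-resp-↭ U↭ x<) ∷ sortedV

  -- The entries of `w` are drawn one by one. What is left matches `xs` only up to rearrangement,
  -- but it inherits the sorting of `U`, which the next cycle relies on.
  splits-∈ : ∀ {k} (U : Vec A k) → AllPairs R (toList U) → (w : List A) {xs : List A} → w ++ xs ↭ toList U →
             ∃₂ λ j V → (w , j , V) ∈ splits U × xs ↭ toList V × AllPairs R (toList V)
  splits-∈ {zero}  U  sorted []      xs↭ = zero , U , here refl , xs↭ , sorted
  splits-∈ {suc k} U  sorted []      xs↭ = suc k , U , here refl , xs↭ , sorted
  splits-∈ {zero}  [] sorted (u ∷ w) xs↭ = contradiction xs↭ ¬x∷xs↭[]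
  splits-∈ {suc k} U  sorted (u ∷ w) xs↭ with picks-∈ U sorted (∈-resp-↭ xs↭ (here refl))
  ... | V , uV∈ , U↭ , sortedV with splits-∈ V sortedV w (drop-∷ (↭-trans xs↭ U↭))
  ... | j , V′ , wV′∈ , xs↭′ , sortedV′ =
    j , V′ , there (∈-concatMap⁺ _ (Any.map (λ { refl → ∈-map⁺ _ wV′∈ }) uV∈)) , xs↭′ , sortedV′

-- The head `h` of the first cycle and the first entry `m` of `U` are both least among the same
-- elements, hence equal. So `w` is split off from `U`, and the induction continues with the sorted
-- remainder.
decompositions-∈ : ∀ {n} (N : ℕ) {k : ℕ} → k ℕ.≤ N → (U : Vec (Fin n) k) → AllPairs _<ᶠ_ (toList U) →
  (γs : List (List⁺ (Fin n))) → AllPairs (_<ᶠ_ on List⁺.head) γs →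
  All (λ γ → All (List⁺.head γ ≤ᶠ_) (List⁺.toList γ)) γs → concatMap List⁺.toList γs ↭ toList U →
  γs ∈ decompositions N U
decompositions-∈ zero    k≤N []      _ []             _ _ _  = here refl
decompositions-∈ (suc N) k≤N []      _ []             _ _ _  = here refl
decompositions-∈ N       k≤N (m ∷ U) _ []             _ _ γs↭ = contradiction (↭-sym γs↭) ¬x∷xs↭[]
decompositions-∈ N       k≤N []      _ ((h ∷ w) ∷ γs) _ _ γs↭ = contradiction γs↭ ¬x∷xs↭[]
decompositions-∈ (suc N) {suc k} (s≤s k≤N) (m ∷ U) (m<U ∷ sorted) ((h ∷ w) ∷ γs)
  (h<γs ∷ sortedγs) ((_ ∷ h≤w) ∷ minimal) γs↭
  with Fin.≤-antisym (All.lookup h≤ (∈-resp-↭ (↭-sym γs↭) (here refl))) (All.lookup m≤ (∈-resp-↭ γs↭ (here refl)))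
  where
  h≤ : All (h ≤ᶠ_) (h ∷ w ++ concatMap List⁺.toList γs)
  h≤ = Fin.≤-refl ∷ All.++⁺ h≤w (All.concat⁺ (All.map⁺ (All.zipWith
    (λ (h<γ , γ≤) → All.map (Fin.≤-trans (ℕ.<⇒≤ h<γ)) γ≤) (h<γs , minimal))))
  m≤ : All (m ≤ᶠ_) (m ∷ toList U)
  m≤ = Fin.≤-refl ∷ All.map ℕ.<⇒≤ m<U
... | refl with splits-∈ U sorted w (drop-∷ γs↭)
... | j , V , wV∈ , γs↭V , sortedV = ∈-concatMap⁺ _ (Any.map
  (λ { refl → ∈-map⁺ _
    (decompositions-∈ N (ℕ.≤-trans (All.lookup (splits-≤ U) wV∈) k≤N) V sortedV γs sortedγs minimal γs↭V) })
  wV∈)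

-- The cycles of a permutation.

graph : ∀ {n} → Permutation′ n → Digraph n
graph σ .Edge  u v = σ ⟨$⟩ʳ u ≡ v
graph σ .edge? u v = (σ ⟨$⟩ʳ u) Fin.≟ v

module _ {n : ℕ} (σ : Permutation′ n) where
  open CycleProperties σ

  -- As `v` is reached in fewer than `m` steps, the list stops because of the return to `v` and not
  -- for lack of iterates. Hence `v` is the image of its last entry.
  takeWhile-linked : ∀ v m x j → j ℕ.< m → power j x ≡ v → ∀ y → σ ⟨$⟩ʳ y ≡ x →
    Linked (Edge (graph σ)) ((y ∷ takeWhile (λ u → ¬? (u Fin.≟ v)) (iterate (σ ⟨$⟩ʳ_) x m)) ∷ʳ v)
  takeWhile-linked v (suc m) x j       j<m       e y y→x with x Fin.≟ v
  ... | yes x≡v = trans y→x x≡v ∷ [-]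
  takeWhile-linked v (suc m) x zero    j<m       e y y→x | no x≢v = contradiction e x≢v
  takeWhile-linked v (suc m) x (suc j) (s≤s j<m) e y y→x | no x≢v =
    y→x ∷ takeWhile-linked v m (σ ⟨$⟩ʳ x) j j<m
      (trans (sym (power-+ j 1 x)) (trans (cong (λ k → power k x) (ℕ.+-comm j 1)) e)) x refl

  cycleFrom-isCycle : ∀ v → IsCycleOf (graph σ) (cycleFrom σ v)
  cycleFrom-isCycle v with period v
  ... | j , j<n , e = takeWhile-linked v n (σ ⟨$⟩ʳ v) j j<n
    (trans (sym (power-+ j 1 v)) (trans (cong (λ k → power k v) (ℕ.+-comm j 1)) e)) v refl

  linked-predecessor : ∀ {v t} x xs → Linked (Edge (graph σ)) ((x ∷ xs) ∷ʳ v) → t ∈ xs →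
                       ∃ λ z → z ∈ x ∷ xs × σ ⟨$⟩ʳ z ≡ t
  linked-predecessor x (y ∷ xs) (x→y ∷ l) (here refl) = x , here refl , x→y
  linked-predecessor x (y ∷ xs) (x→y ∷ l) (there t∈) with linked-predecessor y xs l t∈
  ... | z , z∈ , z→t = z , there z∈ , z→t

  -- A repetition could be pulled back along σ to one of the first entry.
  linked⇒unique : ∀ {v} x xs → Linked (Edge (graph σ)) ((x ∷ xs) ∷ʳ v) → All (x ≢_) xs → Unique (x ∷ xs)
  linked⇒unique x []       _         _    = [] ∷ []
  linked⇒unique x (y ∷ xs) (x→y ∷ l) x∉ys = x∉ys ∷ linked⇒unique y xs l
    (All.tabulate λ t∈ y≡t → let z , z∈ , z→t = linked-predecessor y xs l t∈ in
      All.lookup x∉ys z∈ (Injection.injective (↔⇒↣ σ) (trans x→y (trans y≡t (sym z→t)))))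

  underlying-unique : ∀ v → Unique (underlying σ v)
  underlying-unique v = linked⇒unique v _ (cycleFrom-isCycle v) (All.map (λ u≢v → u≢v ∘ sym) 
    (All.all-takeWhile (λ u → ¬? (u Fin.≟ v)) (iterate (σ ⟨$⟩ʳ_) (σ ⟨$⟩ʳ v) n)))

  ∈-cycles : ∀ {v} → Leader σ v → cycleFrom σ v ∈ cycles σ
  ∈-cycles lead = ∈-map⁺ (cycleFrom σ) (∈-filter⁺ (leader? σ) (∈-allFin _) lead)

  covering : ∀ v → ∃ λ γ → γ ∈ cycles σ × v ∈ List⁺.toList γ
  covering v with hasLeader v
  ... | w , lead , v∈ = cycleFrom σ w , ∈-cycles lead , v∈

  cycles-areCycles : All (IsCycleOf (graph σ)) (cycles σ)
  cycles-areCycles = All.map⁺ (All.universal cycleFrom-isCycle (leaders σ))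

  cycles-disjoint : AllPairs (Disjoint on List⁺.toList) (cycles σ)
  cycles-disjoint = AllPairs.map
    (λ {γ} {δ} d {i} (i∈γ , i∈δ) → d i (∈-⋃⁺ {xs = List⁺.toList γ} i∈γ) (∈-⋃⁺ {xs = List⁺.toList δ} i∈δ))
    (AllPairs.map⁻ (disjoint (Type σ)))

  cycles-↭ : concatMap List⁺.toList (cycles σ) ↭ allFin n
  cycles-↭ = ∼bag⇒↭ (unique∧set⇒bag
    (Unique.concat⁺ (All.map⁺ (All.map⁺ (All.universal underlying-unique (leaders σ))))
      (AllPairs.map⁺ cycles-disjoint))
    (allFin⁺ n)
    (λ {v} → mk⇔ (λ _ → ∈-allFin v)
      (λ _ → let _ , γ∈ , v∈ = covering v in ∈-concatMap⁺ _ (Any.map (λ { refl → v∈ }) γ∈))))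

toList-tabulate : ∀ {n} {A : Set} (f : Fin n → A) → toList (Vec.tabulate f) ≡ tabulate f
toList-tabulate {zero}  f = refl
toList-tabulate {suc n} f = cong (f zero ∷_) (toList-tabulate (f ∘ suc))

allFin-sorted : ∀ n → AllPairs _<ᶠ_ (allFin n)
allFin-sorted n = AllPairs.tabulate⁺-< id

cycles-∈ : ∀ {n} (σ : Permutation′ n) → cycles σ ∈ decompositions n (Vec.allFin n)
cycles-∈ {n} σ = decompositions-∈ n ℕ.≤-refl (Vec.allFin n)
  (subst (AllPairs _<ᶠ_) (sym (toList-tabulate id)) (allFin-sorted n))
  (cycles σ)
  (AllPairs.map⁺ (AllPairs.filter⁺ (leader? σ) (allFin-sorted n)))
  (All.map⁺ (All.all-filter (leader? σ) (allFin n)))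
  (↭-trans (cycles-↭ σ) (↭-reflexive (sym (toList-tabulate id))))

linked-deterministic : ∀ {n} (σ ρ : Permutation′ n) {v c} xs →
  Linked (Edge (graph σ)) (xs ∷ʳ c) → Linked (Edge (graph ρ)) (xs ∷ʳ c) → v ∈ xs → σ ⟨$⟩ʳ v ≡ ρ ⟨$⟩ʳ v
linked-deterministic σ ρ (x ∷ [])     (e ∷ _) (e′ ∷ _)  (here refl) = trans e (sym e′)
linked-deterministic σ ρ (x ∷ y ∷ xs) (e ∷ _) (e′ ∷ _)  (here refl) = trans e (sym e′)
linked-deterministic σ ρ (x ∷ y ∷ xs) (_ ∷ l) (_ ∷ l′)  (there v∈)  = linked-deterministic σ ρ (y ∷ xs) l l′ v∈

-- Each `v` lies on a cycle of `σ`, and that list, being a cycle of `ρ` too, prescribes the same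
-- image of `v`.
cycles-injective : ∀ {n} (σ ρ : Permutation′ n) → cycles σ ≡ cycles ρ → σ ≈ ρ
cycles-injective σ ρ e v with covering σ v
... | c ∷ cs , γ∈ , v∈ = linked-deterministic σ ρ (c ∷ cs)
  (All.lookup (cycles-areCycles σ) γ∈) (All.lookup (cycles-areCycles ρ) (subst (c ∷ cs ∈_) e γ∈)) v∈

-- The bijection between permutations and decompositions.

∏ᶻ-1 : {A : Set} {F : A → ℤ} → (∀ x → F x ≡ 1ℤ) → (xs : List A) → ∏ᶻ xs F ≡ 1ℤ
∏ᶻ-1 e []       = refl
∏ᶻ-1 e (x ∷ xs) = cong₂ _*_ (e x) (∏ᶻ-1 e xs)

module _ {A : Set} where

  edgeless : Weight {A}
  edgeless _ _ = 0ℤ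

  path-edgeless : ∀ w → path (1+e edgeless) (one edgeless) w ≡ 1ℤ
  path-edgeless []      = refl
  path-edgeless (u ∷ w) = trans (ℤ.*-identityˡ _) (path-edgeless w)

  walk-edgeless : ∀ w m → walk (1+e edgeless) (one edgeless) w m ≡ 1ℤ
  walk-edgeless []      m = refl
  walk-edgeless (u ∷ w) m = trans (ℤ.*-identityˡ _) (walk-edgeless w m)

  cycleWeight-edgeless : ∀ γ → cycleWeight edgeless γ ≡ 1ℤ
  cycleWeight-edgeless (m ∷ [])    = refl
  -- The subtracted closed walk has a first step of weight 0, so its weight computes to 0.
  cycleWeight-edgeless (m ∷ u ∷ w) = cong (_- 0ℤ) (walk-edgeless (u ∷ w) m)

-- For e = 0 all paths and all cycles have weight 1.
length-decompositions : ∀ n → length (decompositions n (Vec.allFin n)) ≡ length (permutations n)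
length-decompositions n = ℤ.+-injective (begin
  pos (length (decompositions n (Vec.allFin n)))
    ≡⟨ ∑ᶻ-1 (decompositions n (Vec.allFin n)) ⟨
  ∑ᶻ (decompositions n (Vec.allFin n)) (λ _ → 1ℤ)
    ≡⟨ ∑ᶻ-cong (decompositions n (Vec.allFin n)) (∏ᶻ-1 cycleWeight-edgeless) ⟨
  ∑ᶻ (decompositions n (Vec.allFin n)) (λ γs → ∏ᶻ γs (cycleWeight edgeless))
    ≡⟨ ∑-decompositions edgeless n ℕ.≤-refl (Vec.allFin n) ⟩
  paths₁ edgeless (Vec.allFin n)
    ≡⟨ ∑-permutations {n} (1+e edgeless) (one edgeless) id ⟨
  ∑ᶻ (permutations n) (λ σ → path (1+e edgeless) (one edgeless) (tabulate (σ ⟨$⟩ʳ_)))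
    ≡⟨ ∑ᶻ-cong (permutations n) (λ σ → path-edgeless (tabulate (σ ⟨$⟩ʳ_))) ⟩
  ∑ᶻ (permutations n) (λ _ → 1ℤ)
    ≡⟨ ∑ᶻ-1 (permutations n) ⟩
  pos (length (permutations n)) ∎)

-- `cycles` maps the permutations injectively into the decompositions, and there are equally many of
-- both. This spares the construction of a permutation from given cycles.
cycles-permutations : ∀ n → map cycles (permutations n) ↭ decompositions n (Vec.allFin n)
cycles-permutations n = unique∧⊆∧length⇒↭
  (AllPairs.map⁺ (AllPairs.map (λ {σ} {ρ} σ≉ρ → σ≉ρ ∘ cycles-injective σ ρ) (permutations-distinct n)))
  (λ γs∈ → let σ , _ , eq = ∈-map⁻ cycles γs∈ in subst (_∈ decompositions n (Vec.allFin n)) (sym eq) (cycles-∈ σ))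
  (trans (List.length-map cycles (permutations n)) (sym (length-decompositions n)))

∑-cycles : ∀ {n} (e : Weight) →
  ∑ᶻ (permutations n) (λ σ → path (1+e e) (one e) (tabulate (σ ⟨$⟩ʳ_))) ≡
  ∑ᶻ (permutations n) (λ σ → ∏ᶻ (cycles σ) (cycleWeight e))
∑-cycles {n} e = begin
  ∑ᶻ (permutations n) (λ σ → path (1+e e) (one e) (tabulate (σ ⟨$⟩ʳ_)))
    ≡⟨ ∑-permutations {n} (1+e e) (one e) id ⟩
  paths₁ e (Vec.allFin n)
    ≡⟨ ∑-decompositions e n ℕ.≤-refl (Vec.allFin n) ⟨
  ∑ᶻ (decompositions n (Vec.allFin n)) weight
    ≡⟨ ∑ᶻ-↭ weight (cycles-permutations n) ⟨
  ∑ᶻ (map cycles (permutations n)) weight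
    ≡⟨ ∑ᶻ-map weight cycles (permutations n) ⟩
  ∑ᶻ (permutations n) (λ σ → weight (cycles σ)) ∎
  where
  weight : List (List⁺ (Fin n)) → ℤ
  weight γs = ∏ᶻ γs (cycleWeight e)

-- Weights of linked lists, and closed walks of a transitive relation.

module _ {A : Set} where

  ∑ᶻ-filter : {P : A → Set} (P? : Decidable₁ P) {F G : A → ℤ} →
              (∀ x → P x → F x ≡ G x) → (∀ x → ¬ P x → G x ≡ 0ℤ) →
              (xs : List A) → ∑ᶻ (filter P? xs) F ≡ ∑ᶻ xs G
  ∑ᶻ-filter P? inside outside []       = refl
  ∑ᶻ-filter P? inside outside (x ∷ xs) with P? x
  ... | yes px = cong₂ _+_ (inside x px) (∑ᶻ-filter P? inside outside xs)
  ... | no ¬px = trans (sym (ℤ.+-identityˡ _)) (cong₂ _+_ (sym (outside x ¬px)) (∑ᶻ-filter P? inside outside xs))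

  module _ {R : A → A → Set} {b : Weight {A}} where

    -- The exponent includes the last step, the one to `m`.
    walk-linked : ∀ {c} → (∀ {u v} → R u v → b u v ≡ c) →
                  ∀ u w {m} → Linked R ((u ∷ w) ∷ʳ m) → walk b (b u) w m ≡ c ^ suc (length w)
    walk-linked e u []      (r ∷ _) = trans (e r) (sym (ℤ.*-identityʳ _))
    walk-linked e u (v ∷ w) (r ∷ l) = cong₂ _*_ (e r) (walk-linked e v w l)

    walk-¬linked : Decidable R → (∀ {u v} → ¬ R u v → b u v ≡ 0ℤ) →
                   ∀ u w {m} → ¬ Linked R ((u ∷ w) ∷ʳ m) → walk b (b u) w m ≡ 0ℤ
    walk-¬linked R? e u []      ¬l = e (λ r → ¬l (r ∷ [-]))
    walk-¬linked R? e u (v ∷ w) ¬l with R? u v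
    ... | yes r = trans (cong (b u v *_) (walk-¬linked R? e v w (λ l → ¬l (r ∷ l)))) (ℤ.*-zeroʳ (b u v))
    ... | no ¬r = cong (_* walk b (b v) w _) (e ¬r)

    path-linked : (∀ {u v} → R u v → b u v ≡ 1ℤ) → ∀ u w → Linked R (u ∷ w) → path b (b u) w ≡ 1ℤ
    path-linked e u []      _       = refl
    path-linked e u (v ∷ w) (r ∷ l) = cong₂ _*_ (e r) (path-linked e v w l)

    path-¬linked : Decidable R → (∀ {u v} → ¬ R u v → b u v ≡ 0ℤ) →
                   ∀ u w → ¬ Linked R (u ∷ w) → path b (b u) w ≡ 0ℤ
    path-¬linked R? e u []      ¬l = contradiction [-] ¬l
    path-¬linked R? e u (v ∷ w) ¬l with R? u v
    ... | yes r = trans (cong (b u v *_) (path-¬linked R? e v w (λ l → ¬l (r ∷ l)))) (ℤ.*-zeroʳ (b u v))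
    ... | no ¬r = cong (_* path b (b v) w) (e ¬r)

  linked-last : {R : A → A → Set} → Transitive R → ∀ {d} xs → Linked R (xs ∷ʳ d) → All (λ x → R x d) xs
  linked-last tr []           _       = []
  linked-last tr (x ∷ [])     (r ∷ _) = r ∷ []
  linked-last tr (x ∷ y ∷ xs) (r ∷ l) with linked-last tr (y ∷ xs) l
  ... | y~d ∷ xs~d = tr r y~d ∷ y~d ∷ xs~d

  -- Following the walk from its start relates `c` to every entry, and following it to its end
  -- relates every entry to `c`. For an antisymmetric relation all entries then coincide.
  closed⇒symmetric : {R : A → A → Set} → Transitive R → ∀ {c} xs → Linked R ((c ∷ xs) ∷ʳ c) →
                     All (λ x → R x c × R c x) ((c ∷ xs) ∷ʳ c)
  closed⇒symmetric tr {c} xs l with linked-last tr (c ∷ xs) l | Linked.Linked⇒AllPairs tr l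
  ... | cRc ∷ xsRc | cRxs ∷ _ = (cRc , cRc) ∷ All.zip (All.++⁺ xsRc (cRc ∷ []) , cRxs)

  linked-with-All : {R : A → A → Set} {P : A → Set} {xs : List A} → Linked R xs → All P xs →
                    Linked (λ u v → R u v × P u × P v) xs
  linked-with-All []      _              = []
  linked-with-All [-]     _              = [-]
  linked-with-All (r ∷ l) (pu ∷ pv ∷ ps) = (r , pu , pv) ∷ linked-with-All l (pv ∷ ps)

-- Cycles of ascents and of non-ascents.

module _ {n : ℕ} (f : Fin n → ℙ) (X : Digraph n) where

  -- A listing is friendly when it is a path in this digraph.
  ascents : Digraph n
  ascents .Edge  u v = value (f u) ℕ.≤ value (f v) × (Edge X u v → value (f u) ℕ.< value (f v))
  ascents .edge? u v = (value (f u) ℕ.≤? value (f v)) ×-dec (edge? X u v →-dec (value (f u) ℕ.<? value (f v)))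

  ConstantOn : List⁺ (Fin n) → Set
  ConstantOn γ = ∀ j k → j ∈ˢ support γ → k ∈ˢ support γ → f j ≡ f k

  constantOn⁺ : ∀ c cs → All (λ x → f x ≡ f c) ((c ∷ cs) ∷ʳ c) → ConstantOn (c ∷ cs)
  constantOn⁺ c cs const j k j∈ k∈ = trans (at j∈) (sym (at k∈))
    where
    at : ∀ {j} → j ∈ˢ support (c ∷ cs) → f j ≡ f c
    at j∈ = All.lookup const (∈-++⁺ˡ (∈-⋃⁻ (c ∷ cs) j∈))

  constantOn⁻ : ∀ c cs → ConstantOn (c ∷ cs) → All (λ x → f x ≡ f c) ((c ∷ cs) ∷ʳ c)
  constantOn⁻ c cs const = All.++⁺
    (All.tabulate (λ {x} x∈ → const x c (∈-⋃⁺ {xs = c ∷ cs} x∈) (∈-⋃⁺ {xs = c ∷ cs} (here refl))))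
    (refl ∷ [])

  equal : ∀ {u v c} → f u ≡ f c → f v ≡ f c → value (f u) ≡ value (f v)
  equal u≡c v≡c = cong value (trans u≡c (sym v≡c))

  -- A strict increase is an ascent whether or not it is along an edge.
  ¬ascent⇒≥ : ∀ {u v} → ¬ Edge ascents u v → value (f v) ℕ.≤ value (f u)
  ¬ascent⇒≥ ¬a = ℕ.≮⇒≥ (λ u<v → ¬a (ℕ.<⇒≤ u<v , λ _ → u<v))

  ascent-level : ∀ {u v} → value (f u) ≡ value (f v) → Edge ascents u v → ¬ Edge X u v
  ascent-level u≡v (_ , strict) uv = ℕ.<⇒≢ (strict uv) u≡v

  ¬ascent-level : ∀ {u v} → value (f u) ≡ value (f v) → ¬ Edge ascents u v → Edge X u v
  ¬ascent-level {u} {v} u≡v ¬a with edge? X u v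
  ... | yes uv = uv
  ... | no ¬uv = contradiction (ℕ.≤-reflexive u≡v , λ uv → contradiction uv ¬uv) ¬a

  -- The values of `f` increase weakly around the cycle and so are constant. Between equal values,
  -- an ascent cannot be an edge of `X`.
  ascents-cycle⁻ : ∀ γ → IsCycleOf ascents γ → ConstantOn γ × IsCycleOf (complement X) γ
  ascents-cycle⁻ (c ∷ cs) cyc = constantOn⁺ c cs const ,
    Linked.map (λ (a , u≡c , v≡c) → ascent-level (equal u≡c v≡c) a) (linked-with-All cyc const)
    where
    const : All (λ x → f x ≡ f c) ((c ∷ cs) ∷ʳ c)
    const = All.map (λ (x≤c , c≤x) → value-injective (ℕ.≤-antisym x≤c c≤x))
      (closed⇒symmetric (λ {i} {j} {k} → ℕ.≤-trans {value (f i)} {value (f j)} {value (f k)}) cs (Linked.map proj₁ cyc))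

  ascents-cycle⁺ : ∀ γ → ConstantOn γ → IsCycleOf (complement X) γ → IsCycleOf ascents γ
  ascents-cycle⁺ (c ∷ cs) const cyc =
    Linked.map (λ (¬uv , u≡c , v≡c) → ℕ.≤-reflexive (equal u≡c v≡c) , λ uv → contradiction uv ¬uv)
      (linked-with-All cyc (constantOn⁻ c cs const))

  -- By `¬ascent⇒≥` the values of `f` decrease weakly around the cycle and so are constant. Between
  -- equal values, a non-ascent must be an edge of `X`.
  ¬ascents-cycle⁻ : ∀ γ → IsCycleOf (complement ascents) γ → ConstantOn γ × IsCycleOf X γ
  ¬ascents-cycle⁻ (c ∷ cs) cyc = constantOn⁺ c cs const ,
    Linked.map (λ (¬a , u≡c , v≡c) → ¬ascent-level (equal u≡c v≡c) ¬a) (linked-with-All cyc const)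
    where
    const : All (λ x → f x ≡ f c) ((c ∷ cs) ∷ʳ c)
    const = All.map (λ (c≤x , x≤c) → value-injective (ℕ.≤-antisym x≤c c≤x))
      (closed⇒symmetric (λ {i} {j} {k} j≤i k≤j → ℕ.≤-trans {value (f k)} {value (f j)} {value (f i)} k≤j j≤i) cs
        (Linked.map ¬ascent⇒≥ cyc))

  ¬ascents-cycle⁺ : ∀ γ → ConstantOn γ → IsCycleOf X γ → IsCycleOf (complement ascents) γ
  ¬ascents-cycle⁺ (c ∷ cs) const cyc =
    Linked.map (λ (uv , u≡c , v≡c) a → ascent-level (equal u≡c v≡c) a uv)
      (linked-with-All cyc (constantOn⁻ c cs const))

-- Cycle weights for the matrix of non-edges.

module _ {n : ℕ} (D : Digraph n) where

  -- Even a cycle of length 1 has a step. Consequently at most one of the two closed walk weights in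
  -- `cycleWeight` is nonzero.
  cycle-exclusive : ∀ γ → IsCycleOf D γ → ¬ IsCycleOf (complement D) γ
  cycle-exclusive (c ∷ [])     (r ∷ _) (¬r ∷ _) = ¬r r
  cycle-exclusive (c ∷ d ∷ cs) (r ∷ _) (¬r ∷ _) = ¬r r

  nonEdgeWeight : Weight {Fin n}
  nonEdgeWeight u v with edge? D u v
  ... | yes _ = 0ℤ
  ... | no  _ = -1ℤ

  weight-¬nonEdge : ∀ {u v} → ¬ ¬ Edge D u v → nonEdgeWeight u v ≡ 0ℤ
  weight-¬nonEdge {u} {v} ¬¬uv with edge? D u v
  ... | yes _  = refl
  ... | no ¬uv = contradiction ¬uv ¬¬uv

  weight-nonEdge : ∀ {u v} → ¬ Edge D u v → nonEdgeWeight u v ≡ -1ℤ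
  weight-nonEdge {u} {v} ¬uv with edge? D u v
  ... | yes uv = contradiction uv ¬uv
  ... | no  _  = refl

  1+weight-edge : ∀ {u v} → Edge D u v → 1+e nonEdgeWeight u v ≡ 1ℤ
  1+weight-edge uv = cong (1ℤ +_) (weight-¬nonEdge (λ ¬uv → ¬uv uv))

  1+weight-nonEdge : ∀ {u v} → ¬ Edge D u v → 1+e nonEdgeWeight u v ≡ 0ℤ
  1+weight-nonEdge ¬uv = cong (1ℤ +_) (weight-nonEdge ¬uv)

  closedWalk-cycle : ∀ γ → IsCycleOf D γ → closedWalk nonEdgeWeight (1+e nonEdgeWeight) γ ≡ 1ℤ
  closedWalk-cycle (c ∷ cs) cyc = trans (walk-linked 1+weight-edge c cs cyc) (ℤ.^-zeroˡ (suc (length cs)))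

  closedWalk-¬cycle : ∀ γ → ¬ IsCycleOf D γ → closedWalk nonEdgeWeight (1+e nonEdgeWeight) γ ≡ 0ℤ
  closedWalk-¬cycle (c ∷ cs) = walk-¬linked (edge? D) 1+weight-nonEdge c cs

  closedWalk-cocycle : ∀ γ → IsCycleOf (complement D) γ →
                       closedWalk nonEdgeWeight nonEdgeWeight γ ≡ -1ℤ ^ List⁺.length γ
  closedWalk-cocycle (c ∷ cs) = walk-linked weight-nonEdge c cs

  closedWalk-¬cocycle : ∀ γ → ¬ IsCycleOf (complement D) γ → closedWalk nonEdgeWeight nonEdgeWeight γ ≡ 0ℤ
  closedWalk-¬cocycle (c ∷ cs) = walk-¬linked (edge? (complement D)) weight-¬nonEdge c cs

  weight-cycle : ∀ γ → IsCycleOf D γ → cycleWeight nonEdgeWeight γ ≡ 1ℤ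
  weight-cycle γ cyc = cong₂ _-_ (closedWalk-cycle γ cyc) (closedWalk-¬cocycle γ (cycle-exclusive γ cyc))

  weight-cocycle : ∀ γ → IsCycleOf (complement D) γ →
                   cycleWeight nonEdgeWeight γ ≡ -1ℤ ^ (List⁺.length γ ℕ.∸ 1)
  weight-cocycle γ@(c ∷ cs) cocyc = trans
    (cong₂ _-_ (closedWalk-¬cycle γ (λ cyc → cycle-exclusive γ cyc cocyc)) (closedWalk-cocycle γ cocyc))
    -- `length cs` is one less than the length of the cycle: the minus sign in `cycleWeight` cancels
    -- one factor -1.
    (lemma (-1ℤ ^ length cs))
    where
    lemma : ∀ a → 0ℤ - -1ℤ * a ≡ a
    lemma = solve-∀

  weight-neither : ∀ γ → ¬ IsCycleOf D γ → ¬ IsCycleOf (complement D) γ → cycleWeight nonEdgeWeight γ ≡ 0ℤ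
  weight-neither γ ¬cyc ¬cocyc = cong₂ _-_ (closedWalk-¬cycle γ ¬cyc) (closedWalk-¬cocycle γ ¬cocyc)

  path-1 : ∀ xs → Linked (Edge D) xs → path (1+e nonEdgeWeight) (one nonEdgeWeight) xs ≡ 1ℤ
  path-1 []       l = refl
  path-1 (u ∷ us) l = trans (ℤ.*-identityˡ _) (path-linked 1+weight-edge u us l)

  path-0 : ∀ xs → ¬ Linked (Edge D) xs → path (1+e nonEdgeWeight) (one nonEdgeWeight) xs ≡ 0ℤ
  path-0 []       ¬l = contradiction [] ¬l
  path-0 (u ∷ us) ¬l = trans (ℤ.*-identityˡ _) (path-¬linked (edge? D) 1+weight-nonEdge u us ¬l)

∏ᶻ≡0⊎All : {A : Set} {F : A → ℤ} {P : A → Set} → (∀ x → F x ≡ 0ℤ ⊎ P x) → ∀ xs → ∏ᶻ xs F ≡ 0ℤ ⊎ All P xs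
∏ᶻ≡0⊎All e []       = inj₂ []
∏ᶻ≡0⊎All {F = F} e (x ∷ xs) with e x | ∏ᶻ≡0⊎All e xs
... | inj₁ z | _       = inj₁ (cong (_* ∏ᶻ xs F) z)
... | inj₂ p | inj₁ z  = inj₁ (trans (cong (F x *_) z) (ℤ.*-zeroʳ (F x)))
... | inj₂ p | inj₂ ps = inj₂ (p ∷ ps)

-- The coefficient of a monomial.

module _ {n : ℕ} (f : Fin n → ℙ) (X : Digraph n) where

  descentWeight : Weight {Fin n}
  descentWeight = nonEdgeWeight (ascents f X)

  Contributes : List⁺ (Fin n) → Set
  Contributes γ = (IsCycleOf X γ ⊎ IsCycleOf (complement X) γ) × ConstantOn f X γ

  weight≡0⊎contributes : ∀ γ → cycleWeight descentWeight γ ≡ 0ℤ ⊎ Contributes γ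
  weight≡0⊎contributes γ with isCycleOf? (ascents f X) γ | isCycleOf? (complement (ascents f X)) γ
  ... | yes cyc | _         = let const , X̄ = ascents-cycle⁻ f X γ cyc in inj₂ (inj₂ X̄ , const)
  ... | no _    | yes cocyc = let const , cocyc′ = ¬ascents-cycle⁻ f X γ cocyc in inj₂ (inj₁ cocyc′ , const)
  ... | no ¬cyc | no ¬cocyc = inj₁ (weight-neither (ascents f X) γ ¬cyc ¬cocyc)

  -- Where `f` is constant, a cycle of `X` consists of non-ascents and yields the sign, and a cycle
  -- of the complement consists of ascents and yields 1.
  ∏-contributes : ∀ {γs} → All Contributes γs → ∏ᶻ γs (cycleWeight descentWeight) ≡
                  -1ℤ ^ sum (map (λ γ → List⁺.length γ ℕ.∸ 1) (filter (isCycleOf? X) γs))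
  ∏-contributes []                             = refl
  ∏-contributes {γ ∷ γs} ((cyc , const) ∷ good) with isCycleOf? X γ
  ... | yes isX = trans
    (cong₂ _*_ (weight-cocycle (ascents f X) γ (¬ascents-cycle⁺ f X γ const isX)) (∏-contributes good))
    (sym (ℤ.^-distribˡ-+-* -1ℤ (List⁺.length γ ℕ.∸ 1) _))
  ∏-contributes {γ ∷ γs} ((inj₁ isX , const) ∷ good) | no ¬isX = contradiction isX ¬isX
  ∏-contributes {γ ∷ γs} ((inj₂ isX̄ , const) ∷ good) | no ¬isX = trans
    (cong₂ _*_ (weight-cycle (ascents f X) γ (ascents-cycle⁺ f X γ const isX̄)) (∏-contributes good))
    (ℤ.*-identityˡ _)

  coefficient : Permutation′ n → ℤ
  coefficient σ = if ⌊ constantOnBlocks? (Type σ) f ⌋ then 1ℤ else 0ℤ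

  -- If `f` is constant on all blocks, every cycle contributes. Otherwise not every cycle can
  -- contribute, so a factor vanishes and both sides are 0.
  ∏-𝕊 : ∀ σ → In𝕊 X σ → -1ℤ ^ φ X σ * coefficient σ ≡ ∏ᶻ (cycles σ) (cycleWeight descentWeight)
  ∏-𝕊 σ in𝕊 with constantOnBlocks? (Type σ) f
  ... | yes const = trans (ℤ.*-identityʳ _) (sym (∏-contributes (All.zip (in𝕊 , All.map⁻ const))))
  ... | no ¬const with ∏ᶻ≡0⊎All weight≡0⊎contributes (cycles σ)
  ...   | inj₁ z    = trans (ℤ.*-zeroʳ (-1ℤ ^ φ X σ)) (sym z)
  ...   | inj₂ good = contradiction (All.map⁺ (All.map proj₂ good)) ¬const

  ∏-∉𝕊 : ∀ σ → ¬ In𝕊 X σ → ∏ᶻ (cycles σ) (cycleWeight descentWeight) ≡ 0ℤ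
  ∏-∉𝕊 σ ∉𝕊 with ∏ᶻ≡0⊎All weight≡0⊎contributes (cycles σ)
  ... | inj₁ z    = z
  ... | inj₂ good = contradiction (All.map proj₁ good) ∉𝕊

  #Friendly-∑ : pos (#Friendly f X) ≡ ∑ᶻ (𝕊 X) (λ σ → -1ℤ ^ φ X σ * coefficient σ)
  #Friendly-∑ = begin
    pos (length (filter (friendly? f X) (permutations n)))
      ≡⟨ ∑ᶻ-1 (filter (friendly? f X) (permutations n)) ⟨
    ∑ᶻ (filter (friendly? f X) (permutations n)) (λ _ → 1ℤ)
      ≡⟨ ∑ᶻ-filter (friendly? f X)
           -- The two conditions of `Friendly` merge into one, that the listing is a path in
           -- `ascents`.
           (λ σ fr → sym (path-1 (ascents f X) _ (Linked.zip fr)))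
           (λ σ ¬fr → path-0 (ascents f X) _ (¬fr ∘ Linked.unzip)) (permutations n) ⟩
    ∑ᶻ (permutations n) (λ σ → path (1+e descentWeight) (one descentWeight) (tabulate (σ ⟨$⟩ʳ_)))
      ≡⟨ ∑-cycles descentWeight ⟩
    ∑ᶻ (permutations n) (λ σ → ∏ᶻ (cycles σ) (cycleWeight descentWeight))
      ≡⟨ ∑ᶻ-filter (in𝕊? X) ∏-𝕊 ∏-∉𝕊 (permutations n) ⟨
    ∑ᶻ (𝕊 X) (λ σ → -1ℤ ^ φ X σ * coefficient σ) ∎

-- Comparison of the two series.

∑-apply : {A : Set} (xs : List A) (F : A → Series) (w : List ℙ) → ∑ xs F w ≡ ∑ᶻ xs (λ x → F x w)
∑-apply []       F w = refl
∑-apply (x ∷ xs) F w = cong (F x w +_) (∑-apply xs F w)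

∑-monomials-lookup : (w : List ℙ) (a : (Fin (length w) → ℙ) → ℤ) → ∑-monomials a w ≡ a (List.lookup w)
∑-monomials-lookup w a with length w ℕ.≟ length w
... | yes refl = refl
... | no  ¬e   = contradiction refl ¬e

∑-monomials-≢ : ∀ {n} (w : List ℙ) (a : (Fin n → ℙ) → ℤ) → length w ≢ n → ∑-monomials a w ≡ 0ℤ
∑-monomials-≢ {n} w a ≢ with length w ℕ.≟ n
... | yes refl = contradiction refl ≢
... | no  _    = refl

theorem3p10 : (n : ℕ) (X : Digraph n) →
    W X ≈ˢ ∑ (𝕊 X) (λ σ → (-1ℤ ^ φ X σ) ·ˢ p (Type σ))
theorem3p10 n X w with length w ℕ.≟ n
-- The word is the monomial of the single coloring `List.lookup w`.
... | yes refl = begin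
  pos (#Friendly (List.lookup w) X)
    ≡⟨ #Friendly-∑ (List.lookup w) X ⟩
  ∑ᶻ (𝕊 X) (λ σ → -1ℤ ^ φ X σ * coefficient (List.lookup w) X σ)
    ≡⟨ ∑ᶻ-cong (𝕊 X) (λ σ → cong (-1ℤ ^ φ X σ *_) (∑-monomials-lookup w _)) ⟨
  ∑ᶻ (𝕊 X) (λ σ → -1ℤ ^ φ X σ * p (Type σ) w)
    ≡⟨ ∑-apply (𝕊 X) (λ σ → (-1ℤ ^ φ X σ) ·ˢ p (Type σ)) w ⟨
  ∑ (𝕊 X) (λ σ → (-1ℤ ^ φ X σ) ·ˢ p (Type σ)) w ∎
-- A word of another length has the coefficient 0 on both sides.
... | no w≢n = sym (begin
  ∑ (𝕊 X) (λ σ → (-1ℤ ^ φ X σ) ·ˢ p (Type σ)) w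
    ≡⟨ ∑-apply (𝕊 X) (λ σ → (-1ℤ ^ φ X σ) ·ˢ p (Type σ)) w ⟩
  ∑ᶻ (𝕊 X) (λ σ → -1ℤ ^ φ X σ * p (Type σ) w)
    ≡⟨ ∑ᶻ-cong (𝕊 X) (λ σ → trans (cong (-1ℤ ^ φ X σ *_) (∑-monomials-≢ w _ w≢n)) (ℤ.*-zeroʳ (-1ℤ ^ φ X σ))) ⟩
  ∑ᶻ (𝕊 X) (λ _ → 0ℤ)
    ≡⟨ ∑ᶻ-0 (𝕊 X) ⟩
  0ℤ ∎)
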